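{- Let $\alpha>0$, let $G$ be an arbitrary weighted multigraph, let $i$ and $j$ be distinct vertices of $G$, and let $\varepsilon_{ij}$ be the total weight of all edges of $G$ with terminal vertices $i$ and $j$. Let $\theta_{ij}$ be the cumulative weight of connections between $i$ and $j$ in $G$. Then: 1. $\theta_{ij}=\theta^0_{ij}+\varepsilon_{ij}$, where $\theta^0_{ij}$ is the cumulative weight of connections between $i$ and $j$ in the multigraph resulting from $G$ by the removal of all edges with terminal vertices $i$ and $j$. 2. $\theta_{ij}\ge\varepsilon_{ij}$. 3. $\theta_{ij}=\varepsilon_{ij}$ if and only if $i$ and $j$ are not connected with the other vertices of $G$ (but they can be connected to each other), i.e., no edge of $G$ joins a vertex of $\{i,j\}$ to a vertex outside $\{i,j\}$.
   Context: A weighted multigraph $G$ has finite vertex set $V(G)=\{1,\ldots,n\}$; multiple edges are allowed, loops are not, and all edge weights are strictly positive. Its Laplacian matrix $L=L(G)=(\ell_{ij})$ is given by: for $j\ne i$, $\ell_{ij}$ is minus the sum of the weights of all edges with terminal vertices $i$ and $j$; and $\ell_{ii}=-\sum_{j\neq i}\ell_{ij}$. For a fixed parameter $\alpha>0$, the relative forest accessibility matrix is $Q=(q_{ij})=(I+\alpha L)^{ -1}$, and the adjusted forest distance is $\rho_{ij}=\alpha(q_{ii}+q_{jj}-q_{ij}-q_{ji})$ (this is a metric on $V(G)$). For distinct vertices $i$ and $j$, the cumulative weight of connections between $i$ and $j$ in $G$ is $\theta_{ij}=(\rho_{ij})^{ -1}-(2\alpha)^{ -1}$. An empty sum of edge weights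 is $0$. -}

module Defs where

open import Algebra.Apartness.Bundles using (HeytingField; HeytingCommutativeRing)
open import Algebra.Bundles using (CommutativeRing; RawRing)
import Algebra.Definitions as AlgebraDefinitions
import Algebra.Properties.Ring as RingProperties
import Algebra.Properties.Semiring.Mult as SemiringMult
import Algebra.Properties.Semiring.Sum as SemiringSum
import Algebra.Solver.Ring as RingSolver
open import Algebra.Solver.Ring.AlmostCommutativeRing
  using (_-Raw-AlmostCommutative⟶_; fromCommutativeRing)
open import Data.Bool.Base using (true; false; if_then_else_)
open import Data.Fin.Base using (Fin; zero; suc)
open import Data.Fin.Properties using (_≟_)
open import Data.List.Base using (List; []; _∷_; filter; foldr)
open import Data.List.Properties using (filter-accept; filter-reject)
open import Data.List.Membership.Propositional using (_∈_)
open import Data.Maybe.Base using (Maybe; just; nothing)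
open import Data.Nat.Base as ℕ using (ℕ)
import Data.Nat.Properties as ℕ
open import Data.Product.Base using (∃-syntax; _×_; _,_; proj₁; proj₂)
open import Data.Sum.Base using (_⊎_; inj₁; inj₂)
open import Function.Base using (_∘_)
open import Function.Bundles using (_⇔_; Equivalence)
open import Level using (_⊔_) renaming (suc to lsuc)
open import Relation.Binary.Core using (Rel)
open import Relation.Binary.PropositionalEquality.Core as ≡ using (_≡_; _≢_)
import Relation.Binary.Reasoning.Setoid as SetoidReasoning
open import Relation.Binary.Structures using (IsStrictPartialOrder)
open import Relation.Nullary.Decidable.Core
  using (Dec; does; yes; no; ¬?; _×-dec_; _⊎-dec_)
open import Relation.Nullary.Negation.Core using (¬_; contradiction)

-- Ordered fields without a decidability assumption: constructive models of
-- the real numbers are instances, as are ℚ and all classical ordered fields.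
-- Linearity of the order is expressed by tightness and cotransitivity of _#_.

record OrderedField c ℓ₁ ℓ₂ ℓ₃ : Set (lsuc (c ⊔ ℓ₁ ⊔ ℓ₂ ⊔ ℓ₃)) where
  infix 4 _<_ _≤_
  field
    heytingField : HeytingField c ℓ₁ ℓ₂

  open HeytingField heytingField public

  field
    _<_                  : Rel Carrier ℓ₃
    isStrictPartialOrder : IsStrictPartialOrder _≈_ _<_
    #⇔<⊎>                : ∀ {x y} → x # y ⇔ (x < y ⊎ y < x)
    +-monoʳ-<            : ∀ z {x y} → x < y → z + x < z + y
    *-pos                : ∀ {x y} → 0# < x → 0# < y → 0# < x * y

  _≤_ : Rel Carrier ℓ₃
  x ≤ y = ¬ (y < x)

  commutativeRing : CommutativeRing c ℓ₁
  commutativeRing = HeytingCommutativeRing.commutativeRing heytingCommutativeRing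

-- The standard ring solver with coefficients in ℤ, presented as formal
-- differences of natural numbers.

module IntegerSolver {c ℓ} (R : CommutativeRing c ℓ) where
  open CommutativeRing R
  open RingProperties ring
    using (-‿+-comm; -‿involutive; -0#≈0#; x[y-z]≈xy-xz; [y-z]x≈yx-zx)
  open SemiringMult semiring using (×-homo-+; ×1-homo-*) renaming (_×_ to _·_)
  open SetoidReasoning setoid

  private
    coefficients : RawRing _ _
    coefficients = record
      { Carrier = ℕ × ℕ
      ; _≈_     = _≡_
      ; _+_     = λ (a , b) (c , d) → a ℕ.+ c , b ℕ.+ d
      ; _*_     = λ (a , b) (c , d) → a ℕ.* c ℕ.+ b ℕ.* d , a ℕ.* d ℕ.+ b ℕ.* c
      ; -_      = λ (a , b) → b , a
      ; 0#      = 0 , 0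
      ; 1#      = 1 , 0
      }

    ⟦_⟧ : ℕ × ℕ → Carrier
    ⟦ a , b ⟧ = a · 1# - b · 1#

    interchange : ∀ w x y z → (w + x) + (y + z) ≈ (w + y) + (x + z)
    interchange w x y z = begin
      (w + x) + (y + z)  ≈⟨ +-assoc w x (y + z) ⟩
      w + (x + (y + z))  ≈⟨ +-congˡ (+-assoc x y z) ⟨
      w + ((x + y) + z)  ≈⟨ +-congˡ (+-congʳ (+-comm x y)) ⟩
      w + ((y + x) + z)  ≈⟨ +-congˡ (+-assoc y x z) ⟩
      w + (y + (x + z))  ≈⟨ +-assoc w y (x + z) ⟨
      (w + y) + (x + z)  ∎

    [w+x]-[y+z] : ∀ w x y z → (w + x) - (y + z) ≈ (w - y) + (x - z)
    [w+x]-[y+z] w x y z = begin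
      (w + x) - (y + z)      ≈⟨ +-congˡ (-‿+-comm y z) ⟨
      (w + x) + (- y + - z)  ≈⟨ interchange w x (- y) (- z) ⟩
      (w - y) + (x - z)      ∎

    -[x-y] : ∀ x y → - (x - y) ≈ y - x
    -[x-y] x y = begin
      - (x - y)    ≈⟨ -‿+-comm x (- y) ⟨
      - x + - - y  ≈⟨ +-congˡ (-‿involutive y) ⟩
      - x + y      ≈⟨ +-comm (- x) y ⟩
      y - x        ∎

    ×-homo-+-* : ∀ a b c d →
      (a ℕ.* b ℕ.+ c ℕ.* d) · 1# ≈ (a · 1#) * (b · 1#) + (c · 1#) * (d · 1#)
    ×-homo-+-* a b c d =
      trans (×-homo-+ 1# (a ℕ.* b) (c ℕ.* d)) (+-cong (×1-homo-* a b) (×1-homo-* c d))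

    morphism : coefficients -Raw-AlmostCommutative⟶ fromCommutativeRing R
    morphism = record
      { ⟦_⟧    = ⟦_⟧
      ; +-homo = λ (a , b) (c , d) → begin
          (a ℕ.+ c) · 1# - (b ℕ.+ d) · 1#
            ≈⟨ +-cong (×-homo-+ 1# a c) (-‿cong (×-homo-+ 1# b d)) ⟩
          (a · 1# + c · 1#) - (b · 1# + d · 1#)
            ≈⟨ [w+x]-[y+z] _ _ _ _ ⟩
          ⟦ a , b ⟧ + ⟦ c , d ⟧ ∎
      ; *-homo = λ (a , b) (c , d) →
          let a′ = a · 1#; b′ = b · 1#; c′ = c · 1#; d′ = d · 1# in begin
          (a ℕ.* c ℕ.+ b ℕ.* d) · 1# - (a ℕ.* d ℕ.+ b ℕ.* c) · 1#
            ≈⟨ +-cong (×-homo-+-* a c b d) (-‿cong (×-homo-+-* a d b c)) ⟩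
          (a′ * c′ + b′ * d′) - (a′ * d′ + b′ * c′)
            ≈⟨ [w+x]-[y+z] _ _ _ _ ⟩
          (a′ * c′ - a′ * d′) + (b′ * d′ - b′ * c′)
            ≈⟨ +-cong (x[y-z]≈xy-xz a′ c′ d′) (-[x-y] (b′ * c′) (b′ * d′)) ⟨
          a′ * (c′ - d′) - (b′ * c′ - b′ * d′)
            ≈⟨ +-congˡ (-‿cong (x[y-z]≈xy-xz b′ c′ d′)) ⟨
          a′ * (c′ - d′) - b′ * (c′ - d′)
            ≈⟨ [y-z]x≈yx-zx (c′ - d′) a′ b′ ⟨
          (a′ - b′) * (c′ - d′) ∎
      ; -‿homo = λ (a , b) → sym (-[x-y] (a · 1#) (b · 1#))
      ; 0-homo = -‿inverseʳ 0#
      ; 1-homo = trans (+-cong (+-identityʳ 1#) -0#≈0#) (+-identityʳ 1#)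
      }

    _coeff≟_ : ∀ x y → Maybe (⟦ x ⟧ ≈ ⟦ y ⟧)
    (a , b) coeff≟ (c , d) with a ℕ.+ d ℕ.≟ c ℕ.+ b
    ... | no  _  = nothing
    ... | yes eq = just (begin
      a′ - b′               ≈⟨ +-identityʳ _ ⟨
      (a′ - b′) + 0#        ≈⟨ +-congˡ (-‿inverseʳ d′) ⟨
      (a′ - b′) + (d′ - d′) ≈⟨ [w+x]-[y+z] a′ d′ b′ d′ ⟨
      (a′ + d′) - (b′ + d′) ≈⟨ +-congʳ a′+d′≈c′+b′ ⟩
      (c′ + b′) - (b′ + d′) ≈⟨ +-congˡ (-‿cong (+-comm b′ d′)) ⟩
      (c′ + b′) - (d′ + b′) ≈⟨ [w+x]-[y+z] c′ b′ d′ b′ ⟩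
      (c′ - d′) + (b′ - b′) ≈⟨ +-congˡ (-‿inverseʳ b′) ⟩
      (c′ - d′) + 0#        ≈⟨ +-identityʳ _ ⟩
      c′ - d′               ∎)
      where
      a′ = a · 1#
      b′ = b · 1#
      c′ = c · 1#
      d′ = d · 1#
      a′+d′≈c′+b′ : a′ + d′ ≈ c′ + b′
      a′+d′≈c′+b′ = begin
        a′ + d′         ≈⟨ ×-homo-+ 1# a d ⟨
        (a ℕ.+ d) · 1#  ≡⟨ ≡.cong (_· 1#) eq ⟩
        (c ℕ.+ b) · 1#  ≈⟨ ×-homo-+ 1# c b ⟩
        c′ + b′         ∎

  open RingSolver coefficients (fromCommutativeRing R) morphism _coeff≟_ public
    using (solve; _:=_; _:+_; _:*_; _:-_; :-_; con)

module OrderedFieldProperties {c ℓ₁ ℓ₂ ℓ₃} (F : OrderedField c ℓ₁ ℓ₂ ℓ₃) where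
  open OrderedField F hiding (zero)
  open CommutativeRing commutativeRing using (ring; semiring)
  open RingProperties ring using (-0#≈0#)
  open IntegerSolver commutativeRing
  open SemiringSum semiring using (sum)
  open IsStrictPartialOrder isStrictPartialOrder public
    using (<-respˡ-≈; <-respʳ-≈)
    renaming (irrefl to <-irrefl; trans to <-trans; asym to <-asym)
  open SetoidReasoning setoid

  x-0≈x : ∀ x → x - 0# ≈ x
  x-0≈x x = trans (+-congˡ -0#≈0#) (+-identityʳ x)

  <⇒# : ∀ {x y} → x < y → x # y
  <⇒# = Equivalence.from #⇔<⊎> ∘ inj₁

  #⇒<⊎> : ∀ {x y} → x # y → x < y ⊎ y < x
  #⇒<⊎> = Equivalence.to #⇔<⊎>

  pos⇒# : ∀ {x} → 0# < x → x # 0#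
  pos⇒# = #-sym ∘ <⇒#

  <-cotrans : ∀ {x y} → x < y → ∀ z → x < z ⊎ z < y
  <-cotrans x<y z with #-cotrans (<⇒# x<y) z
  ... | inj₁ x#z with #⇒<⊎> x#z
  ...   | inj₁ x<z = inj₁ x<z
  ...   | inj₂ z<x = inj₂ (<-trans z<x x<y)
  <-cotrans x<y z | inj₂ z#y with #⇒<⊎> z#y
  ...   | inj₁ z<y = inj₂ z<y
  ...   | inj₂ y<z = inj₁ (<-trans x<y y<z)

  private
    -z+[z+x]≈x : ∀ z x → - z + (z + x) ≈ x
    -z+[z+x]≈x = solve 2 (λ z x → (:- z :+ (z :+ x)) := x) refl

  +-cancelˡ-< : ∀ z {x y} → z + x < z + y → x < y
  +-cancelˡ-< z {x} {y} lt =
    <-respˡ-≈ (-z+[z+x]≈x z x) (<-respʳ-≈ (-z+[z+x]≈x z y) (+-monoʳ-< (- z) lt))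

  x<x+y⇒0<y : ∀ {x y} → x < x + y → 0# < y
  x<x+y⇒0<y {x} lt = +-cancelˡ-< x (<-respˡ-≈ (sym (+-identityʳ x)) lt)

  x+y<x⇒y<0 : ∀ {x y} → x + y < x → y < 0#
  x+y<x⇒y<0 {x} lt = +-cancelˡ-< x (<-respʳ-≈ (sym (+-identityʳ x)) lt)

  neg⇒-pos : ∀ {x} → x < 0# → 0# < - x
  neg⇒-pos {x} x<0 = <-respˡ-≈ (-‿inverseˡ x) (<-respʳ-≈ (+-identityʳ (- x)) (+-monoʳ-< (- x) x<0))

  #⇒sq-pos : ∀ {x} → x # 0# → 0# < x * x
  #⇒sq-pos {x} x#0 with #⇒<⊎> x#0
  ... | inj₂ 0<x = *-pos 0<x 0<x
  ... | inj₁ x<0 = <-respʳ-≈ (solve 1 (λ x → ((:- x) :* (:- x)) := (x :* x)) refl x)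
                     (*-pos (neg⇒-pos x<0) (neg⇒-pos x<0))

  pos+nonneg : ∀ {x y} → 0# < x → 0# ≤ y → 0# < x + y
  pos+nonneg {x} {y} 0<x 0≤y with <-cotrans 0<x (x + y)
  ... | inj₁ 0<x+y = 0<x+y
  ... | inj₂ x+y<x = contradiction (x+y<x⇒y<0 x+y<x) 0≤y

  nonneg+pos : ∀ {x y} → 0# ≤ x → 0# < y → 0# < x + y
  nonneg+pos 0≤x 0<y = <-respʳ-≈ (+-comm _ _) (pos+nonneg 0<y 0≤x)

  pos⇒nonneg : ∀ {x} → 0# < x → 0# ≤ x
  pos⇒nonneg = <-asym

  +-nonneg : ∀ {x y} → 0# ≤ x → 0# ≤ y → 0# ≤ x + y
  +-nonneg {x} 0≤x 0≤y x+y<0 with <-cotrans x+y<0 x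
  ... | inj₁ x+y<x = 0≤y (x+y<x⇒y<0 x+y<x)
  ... | inj₂ x<0   = 0≤x x<0

  0<1 : 0# < 1#
  0<1 = <-respʳ-≈ (*-identityˡ 1#) (#⇒sq-pos (invertible⇒#
    (1# , trans (*-identityˡ _) (x-0≈x 1#) , trans (*-identityʳ _) (x-0≈x 1#))))

  *-nonneg : ∀ {x y} → 0# ≤ x → 0# ≤ y → 0# ≤ x * y
  *-nonneg {x} {y} 0≤x 0≤y xy<0 = <-irrefl (trans (*-congʳ x≈0) (zeroˡ y)) xy<0
    where
    y≯0 : 0# < x → ¬ (0# < y)
    y≯0 0<x 0<y = <-asym xy<0 (*-pos 0<x 0<y)

    y≈0 : 0# < x → y ≈ 0#
    y≈0 0<x = proj₁ (tight y 0#) λ y#0 → case# y#0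
      where
      case# : ¬ (y # 0#)
      case# y#0 with #⇒<⊎> y#0
      ... | inj₁ y<0 = 0≤y y<0
      ... | inj₂ 0<y = y≯0 0<x 0<y

    x≈0 : x ≈ 0#
    x≈0 = proj₁ (tight x 0#) λ x#0 → case# x#0
      where
      case# : ¬ (x # 0#)
      case# x#0 with #⇒<⊎> x#0
      ... | inj₁ x<0 = 0≤x x<0
      ... | inj₂ 0<x = <-irrefl (trans (*-congˡ (y≈0 0<x)) (zeroʳ x)) xy<0

  sq-nonneg : ∀ x → 0# ≤ x * x
  sq-nonneg x x²<0 = <-irrefl (trans (*-congʳ x≈0) (zeroˡ x)) x²<0
    where
    x≈0 : x ≈ 0#
    x≈0 = proj₁ (tight x 0#) λ x#0 → <-asym x²<0 (#⇒sq-pos x#0)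

  #-cong : ∀ {x y z} → x ≈ y → x # z → y # z
  #-cong x≈y x#z with #⇒<⊎> x#z
  ... | inj₁ x<z = <⇒# (<-respˡ-≈ x≈y x<z)
  ... | inj₂ z<x = #-sym (<⇒# (<-respʳ-≈ x≈y z<x))

  +-#0 : ∀ {x y} → x + y # 0# → x # 0# ⊎ y # 0#
  +-#0 {x} {y} x+y#0 with #-cotrans (#-sym x+y#0) x
  ... | inj₁ 0#x = inj₁ (#-sym 0#x)
  ... | inj₂ x#x+y with #⇒<⊎> x#x+y
  ...   | inj₁ x<x+y = inj₂ (pos⇒# (x<x+y⇒0<y x<x+y))
  ...   | inj₂ x+y<x = inj₂ (<⇒# (x+y<x⇒y<0 x+y<x))

  -- #⇒invertible inverts x - 0#, which is only ≈ to x.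

  inv : ∀ x → x # 0# → Carrier
  inv x x#0 = proj₁ (#⇒invertible x#0)

  inv-inverseʳ : ∀ x (x#0 : x # 0#) → x * inv x x#0 ≈ 1#
  inv-inverseʳ x x#0 =
    trans (*-congʳ (sym (x-0≈x x))) (proj₂ (proj₂ (#⇒invertible x#0)))

  *-#0ʳ : ∀ {x y} → x * y # 0# → y # 0#
  *-#0ʳ {x} {y} xy#0 = invertible⇒#
    (xy⁻¹ * x , trans (*-congˡ (x-0≈x y)) left , trans (*-congʳ (x-0≈x y)) right)
    where
    xy⁻¹ = inv (x * y) xy#0
    right : y * (xy⁻¹ * x) ≈ 1#
    right = trans (solve 3 (λ x y z → (y :* (z :* x)) := ((x :* y) :* z)) refl x y xy⁻¹)
              (inv-inverseʳ (x * y) xy#0)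
    left : (xy⁻¹ * x) * y ≈ 1#
    left = trans (*-comm (xy⁻¹ * x) y) right

  sum-nonneg : ∀ {n} (f : Fin n → Carrier) → (∀ k → 0# ≤ f k) → 0# ≤ sum f
  sum-nonneg {ℕ.zero}  f 0≤f = <-irrefl refl
  sum-nonneg {ℕ.suc n} f 0≤f = +-nonneg (0≤f zero) (sum-nonneg (f ∘ suc) (0≤f ∘ suc))

  sum-pos : ∀ {n} (f : Fin n → Carrier) → (∀ k → 0# ≤ f k) → ∀ i → 0# < f i → 0# < sum f
  sum-pos f 0≤f zero    0<fi = pos+nonneg 0<fi (sum-nonneg (f ∘ suc) (0≤f ∘ suc))
  sum-pos f 0≤f (suc i) 0<fi = nonneg+pos (0≤f zero) (sum-pos (f ∘ suc) (0≤f ∘ suc) i 0<fi)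

module Forest {c ℓ₁ ℓ₂ ℓ₃} (F : OrderedField c ℓ₁ ℓ₂ ℓ₃) where
  open OrderedField F hiding (zero)
  open CommutativeRing commutativeRing using (ring; semiring)
  open RingProperties ring using (-0#≈0#; -1*x≈-x)
  open OrderedFieldProperties F
  open IntegerSolver commutativeRing
  open SemiringSum semiring
  open SetoidReasoning setoid

  -- The ends are stored in an arbitrary order: edges are undirected, and the
  -- notions below are all stated through Joins, which is symmetric.

  record Edge (n : ℕ) : Set (c ⊔ ℓ₃) where
    field
      end₁ end₂  : Fin n
      end₁≢end₂  : end₁ ≢ end₂
      weight     : Carrier
      weight-pos : 0# < weight

  open Edge public

  Multigraph : ℕ → Set (c ⊔ ℓ₃)
  Multigraph n = List (Edge n)

  Matrix : ℕ → Set c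
  Matrix n = Fin n → Fin n → Carrier

  private
    variable
      n : ℕ

  Joins : Fin n → Fin n → Edge n → Set
  Joins i j e = (end₁ e ≡ i × end₂ e ≡ j) ⊎ (end₁ e ≡ j × end₂ e ≡ i)

  joins? : (i j : Fin n) (e : Edge n) → Dec (Joins i j e)
  joins? i j e = (end₁ e ≟ i ×-dec end₂ e ≟ j) ⊎-dec (end₁ e ≟ j ×-dec end₂ e ≟ i)

  totalWeight : Multigraph n → Carrier
  totalWeight = foldr (λ e s → weight e + s) 0#

  ε : Multigraph n → Fin n → Fin n → Carrier
  ε G i j = totalWeight (filter (joins? i j) G)

  removeEdges : Multigraph n → Fin n → Fin n → Multigraph n
  removeEdges G i j = filter (¬? ∘ joins? i j) G

  JoinedToOutside : Multigraph n → Fin n → Fin n → Set (c ⊔ ℓ₃)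
  JoinedToOutside G i j =
    ∃[ e ] ∃[ u ] ∃[ v ] e ∈ G × Joins u v e × (u ≡ i ⊎ u ≡ j) × (v ≢ i × v ≢ j)

  infix  4 _≋_
  infixl 6 _⊞_
  infixl 7 _⊡_ _⊗_

  _≋_ : Rel (Matrix n) ℓ₁
  A ≋ B = ∀ i j → A i j ≈ B i j

  _⊞_ : Matrix n → Matrix n → Matrix n
  (A ⊞ B) i j = A i j + B i j

  _⊡_ : Carrier → Matrix n → Matrix n
  (a ⊡ A) i j = a * A i j

  _⊗_ : Matrix n → Matrix n → Matrix n
  _⊗_ {n} A B i j = ∑[ k < n ] (A i k * B k j)

  I : Matrix n
  I i j = if does (i ≟ j) then 1# else 0#

  offDiagonal : Multigraph n → Matrix n
  offDiagonal G i j = if does (i ≟ j) then 0# else - ε G i j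

  laplacian : Multigraph n → Matrix n
  laplacian {n} G i j =
    if does (i ≟ j) then - (∑[ k < n ] offDiagonal G i k) else - ε G i j

  open module MatrixDefinitions {n} = AlgebraDefinitions (_≋_ {n}) using (Invertible)

  -- I + αL is inverted by adding the edges one at a time: with x = e_u - e_v
  -- for the ends u, v of the new edge, and p = Qx, the inverse Q changes by a
  -- multiple of p pᵀ (Sherman–Morrison).  To this end the Laplacian is first
  -- written as an operator, a sum of rank-one terms w x xᵀ.

  χ : Fin n → Fin n → Fin n → Carrier
  χ u v i = I i u - I i v

  lap : Multigraph n → (Fin n → Carrier) → Fin n → Carrier
  lap []      y i = 0#
  lap (e ∷ G) y i =
    weight e * (χ (end₁ e) (end₂ e) i * (y (end₁ e) - y (end₂ e))) + lap G y i

  energy : Multigraph n → (Fin n → Carrier) → Carrier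
  energy []      y = 0#
  energy (e ∷ G) y =
    weight e * ((y (end₁ e) - y (end₂ e)) * (y (end₁ e) - y (end₂ e))) + energy G y

  IsResolvent : Multigraph n → Carrier → Matrix n → Set ℓ₁
  IsResolvent G α Q = ∀ i j → Q i j + α * lap G (λ k → Q k j) i ≈ I i j

  IsSymmetric : Matrix n → Set ℓ₁
  IsSymmetric A = ∀ i j → A i j ≈ A j i

  I-diag : (i : Fin n) → I i i ≈ 1#
  I-diag i with i ≟ i
  ... | yes _   = refl
  ... | no  i≢i = contradiction ≡.refl i≢i

  I-off : {i j : Fin n} → i ≢ j → I i j ≈ 0#
  I-off {i = i} {j} i≢j with i ≟ j
  ... | yes i≡j = contradiction i≡j i≢j
  ... | no  _   = refl

  I-sym : IsSymmetric (I {n})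
  I-sym i j with i ≟ j
  ... | yes ≡.refl = sym (I-diag i)
  ... | no  i≢j    = sym (I-off (i≢j ∘ ≡.sym))

  I-* : (i u : Fin n) (y : Fin n → Carrier) → I i u * y i ≈ I i u * y u
  I-* i u y with i ≟ u
  ... | yes ≡.refl = refl
  ... | no  _      = trans (zeroˡ (y i)) (sym (zeroˡ (y u)))

  sum-I : (u : Fin n) (y : Fin n → Carrier) → ∑[ k < n ] (I k u * y k) ≈ y u
  sum-I {ℕ.suc n} zero y = begin
    1# * y zero + ∑[ k < n ] (0# * y (suc k))
      ≈⟨ +-cong (*-identityˡ _) (sum-cong-≋ (λ k → zeroˡ (y (suc k)))) ⟩
    y zero + ∑[ k < n ] 0#
      ≈⟨ +-congˡ (sum-replicate-zero n) ⟩
    y zero + 0#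
      ≈⟨ +-identityʳ _ ⟩
    y zero ∎
  sum-I {ℕ.suc n} (suc u) y = begin
    0# * y zero + ∑[ k < n ] (I k u * y (suc k))
      ≈⟨ +-cong (zeroˡ _) (sum-I u (y ∘ suc)) ⟩
    0# + y (suc u)
      ≈⟨ +-identityˡ _ ⟩
    y (suc u) ∎

  sum-I₂ : (u v : Fin n) (a b : Carrier) (y : Fin n → Carrier) →
    ∑[ k < n ] ((a * I k u + b * I k v) * y k) ≈ a * y u + b * y v
  sum-I₂ {n} u v a b y = begin
    ∑[ k < n ] ((a * I k u + b * I k v) * y k)
      ≈⟨ sum-cong-≋ (λ k → solve 5 (λ a b iu iv y →
           (((a :* iu) :+ (b :* iv)) :* y) := ((iu :* (a :* y)) :+ (iv :* (b :* y))))
           refl a b (I k u) (I k v) (y k)) ⟩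
    ∑[ k < n ] (I k u * (a * y k) + I k v * (b * y k))
      ≈⟨ ∑-distrib-+ (λ k → I k u * (a * y k)) (λ k → I k v * (b * y k)) ⟩
    ∑[ k < n ] (I k u * (a * y k)) + ∑[ k < n ] (I k v * (b * y k))
      ≈⟨ +-cong (sum-I u (λ k → a * y k)) (sum-I v (λ k → b * y k)) ⟩
    a * y u + b * y v ∎

  sum-χ : (u v : Fin n) (y : Fin n → Carrier) → ∑[ k < n ] (y k * χ u v k) ≈ y u - y v
  sum-χ {n} u v y = begin
    ∑[ k < n ] (y k * (I k u - I k v))
      ≈⟨ sum-cong-≋ (λ k → trans (*-comm _ _) (*-congʳ (+-cong (sym (*-identityˡ _)) (-iv k)))) ⟩
    ∑[ k < n ] ((1# * I k u + - 1# * I k v) * y k)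
      ≈⟨ sum-I₂ u v 1# (- 1#) y ⟩
    1# * y u + - 1# * y v
      ≈⟨ +-cong (*-identityˡ _) (-1*x≈-x (y v)) ⟩
    y u - y v ∎
    where
    -iv : ∀ k → - I k v ≈ - 1# * I k v
    -iv k = sym (-1*x≈-x (I k v))

  sum-lap : ∀ G (y : Fin n → Carrier) → ∑[ k < n ] (y k * lap G y k) ≈ energy G y
  sum-lap {n} [] y = begin
    ∑[ k < n ] (y k * 0#)  ≈⟨ sum-cong-≋ (λ k → zeroʳ (y k)) ⟩
    ∑[ k < n ] 0#          ≈⟨ sum-replicate-zero n ⟩
    0#                     ∎
  sum-lap {n} (e ∷ G) y = begin
    ∑[ k < n ] (y k * (w * (χ u v k * d) + lap G y k))
      ≈⟨ sum-cong-≋ (λ k → solve 5 (λ y w χ d l →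
           (y :* ((w :* (χ :* d)) :+ l)) := (((w :* d) :* (y :* χ)) :+ (y :* l)))
           refl (y k) w (χ u v k) d (lap G y k)) ⟩
    ∑[ k < n ] ((w * d) * (y k * χ u v k) + y k * lap G y k)
      ≈⟨ ∑-distrib-+ (λ k → (w * d) * (y k * χ u v k)) (λ k → y k * lap G y k) ⟩
    ∑[ k < n ] ((w * d) * (y k * χ u v k)) + ∑[ k < n ] (y k * lap G y k)
      ≈⟨ +-cong (sym (*-distribˡ-sum (w * d) (λ k → y k * χ u v k))) (sum-lap G y) ⟩
    (w * d) * (∑[ k < n ] (y k * χ u v k)) + energy G y
      ≈⟨ +-congʳ (trans (*-congˡ (sum-χ u v y)) (*-assoc w d d)) ⟩
    w * (d * d) + energy G y ∎
    where
    w = weight e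
    u = end₁ e
    v = end₂ e
    d = y u - y v

  lap-cong : ∀ G {y z : Fin n → Carrier} → (∀ k → y k ≈ z k) → ∀ i → lap G y i ≈ lap G z i
  lap-cong []      y≈z i = refl
  lap-cong (e ∷ G) y≈z i =
    +-cong (*-congˡ (*-congˡ (+-cong (y≈z _) (-‿cong (y≈z _))))) (lap-cong G y≈z i)

  lap-linear : ∀ G (y z : Fin n → Carrier) a i →
    lap G (λ k → y k - a * z k) i ≈ lap G y i - a * lap G z i
  lap-linear [] y z a i = begin
    0#           ≈⟨ -‿inverseʳ 0# ⟨
    0# - 0#      ≈⟨ +-congˡ (-‿cong (zeroʳ a)) ⟨
    0# - a * 0#  ∎
  lap-linear (e ∷ G) y z a i = begin
    w * (x * ((y u - a * z u) - (y v - a * z v))) + lap G (λ k → y k - a * z k) i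
      ≈⟨ +-congˡ (lap-linear G y z a i) ⟩
    w * (x * ((y u - a * z u) - (y v - a * z v))) + (lap G y i - a * lap G z i)
      ≈⟨ solve 9 (λ w x a yu yv zu zv ly lz →
           ((w :* (x :* ((yu :- (a :* zu)) :- (yv :- (a :* zv))))) :+ (ly :- (a :* lz)))
           := (((w :* (x :* (yu :- yv))) :+ ly) :- (a :* ((w :* (x :* (zu :- zv))) :+ lz))))
           refl w x a (y u) (y v) (z u) (z v) (lap G y i) (lap G z i) ⟩
    (w * (x * (y u - y v)) + lap G y i) - a * (w * (x * (z u - z v)) + lap G z i) ∎
    where
    w = weight e
    u = end₁ e
    v = end₂ e
    x = χ u v i

  lap-sub : ∀ G (y z : Fin n → Carrier) i →
    lap G (λ k → y k - z k) i ≈ lap G y i - lap G z i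
  lap-sub G y z i = begin
    lap G (λ k → y k - z k) i       ≈⟨ lap-cong G (λ k → +-congˡ (-‿cong (*-identityˡ (z k)))) i ⟨
    lap G (λ k → y k - 1# * z k) i  ≈⟨ lap-linear G y z 1# i ⟩
    lap G y i - 1# * lap G z i      ≈⟨ +-congˡ (-‿cong (*-identityˡ _)) ⟩
    lap G y i - lap G z i           ∎

  energy-nonneg : ∀ G (y : Fin n → Carrier) → 0# ≤ energy G y
  energy-nonneg []      y = <-irrefl refl
  energy-nonneg (e ∷ G) y =
    +-nonneg (*-nonneg (pos⇒nonneg (weight-pos e)) (sq-nonneg _)) (energy-nonneg G y)

  lap#0⇒energy-pos : ∀ G (y : Fin n → Carrier) i → lap G y i # 0# → 0# < energy G y
  lap#0⇒energy-pos []      y i 0#0 = contradiction 0#0 (#-irrefl refl)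
  lap#0⇒energy-pos (e ∷ G) y i l#0 with +-#0 l#0
  ... | inj₁ t#0 = pos+nonneg
        (*-pos (weight-pos e) (#⇒sq-pos (*-#0ʳ (*-#0ʳ t#0)))) (energy-nonneg G y)
  ... | inj₂ l#0 = nonneg+pos
        (*-nonneg (pos⇒nonneg (weight-pos e)) (sq-nonneg _)) (lap#0⇒energy-pos G y i l#0)

  module Resolvent (G : Multigraph n) (α : Carrier) (Q : Matrix n) (Q-res : IsResolvent G α Q) where

    potential : Fin n → Fin n → Fin n → Carrier
    potential u v k = Q k u - Q k v

    drop : Fin n → Fin n → Carrier
    drop u v = potential u v u - potential u v v

    potential-eq : ∀ u v i → potential u v i + α * lap G (potential u v) i ≈ χ u v i
    potential-eq u v i = begin
      (Q i u - Q i v) + α * lap G (potential u v) i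
        ≈⟨ +-congˡ (*-congˡ (lap-sub G (λ k → Q k u) (λ k → Q k v) i)) ⟩
      (Q i u - Q i v) + α * (lu - lv)
        ≈⟨ solve 5 (λ a b α lu lv →
             ((a :- b) :+ (α :* (lu :- lv))) := ((a :+ (α :* lu)) :- (b :+ (α :* lv))))
             refl (Q i u) (Q i v) α lu lv ⟩
      (Q i u + α * lu) - (Q i v + α * lv)
        ≈⟨ +-cong (Q-res i u) (-‿cong (Q-res i v)) ⟩
      χ u v i ∎
      where
      lu = lap G (λ k → Q k u) i
      lv = lap G (λ k → Q k v) i

    drop-eq : ∀ u v → let p = potential u v in
      drop u v ≈ ∑[ k < n ] (p k * p k) + α * energy G p
    drop-eq u v = begin
      p u - p v
        ≈⟨ sum-χ u v p ⟨
      ∑[ k < n ] (p k * χ u v k)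
        ≈⟨ sum-cong-≋ (λ k → *-congˡ (potential-eq u v k)) ⟨
      ∑[ k < n ] (p k * (p k + α * lap G p k))
        ≈⟨ sum-cong-≋ (λ k → solve 3 (λ p α l →
             (p :* (p :+ (α :* l))) := ((p :* p) :+ (α :* (p :* l)))) refl (p k) α (lap G p k)) ⟩
      ∑[ k < n ] (p k * p k + α * (p k * lap G p k))
        ≈⟨ ∑-distrib-+ (λ k → p k * p k) (λ k → α * (p k * lap G p k)) ⟩
      ∑[ k < n ] (p k * p k) + ∑[ k < n ] (α * (p k * lap G p k))
        ≈⟨ +-congˡ (*-distribˡ-sum α (λ k → p k * lap G p k)) ⟨
      ∑[ k < n ] (p k * p k) + α * (∑[ k < n ] (p k * lap G p k))
        ≈⟨ +-congˡ (*-congˡ (sum-lap G p)) ⟩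
      ∑[ k < n ] (p k * p k) + α * energy G p ∎
      where
      p = potential u v

    drop-pos : 0# < α → ∀ {u v} → u ≢ v → 0# < drop u v
    drop-pos 0<α {u} {v} u≢v = <-respʳ-≈ (sym (drop-eq u v)) pos
      where
      p = potential u v

      squares-nonneg : ∀ k → 0# ≤ p k * p k
      squares-nonneg k = sq-nonneg (p k)

      p+αlap≈1 : p u + α * lap G p u ≈ 1#
      p+αlap≈1 = begin
        p u + α * lap G p u  ≈⟨ potential-eq u v u ⟩
        I u u - I u v        ≈⟨ +-cong (I-diag u) (-‿cong (I-off u≢v)) ⟩
        1# - 0#              ≈⟨ x-0≈x 1# ⟩
        1#                   ∎

      pos : 0# < ∑[ k < n ] (p k * p k) + α * energy G p
      pos with +-#0 (#-cong (sym p+αlap≈1) (pos⇒# 0<1))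
      ... | inj₁ p#0 = pos+nonneg
            (sum-pos _ squares-nonneg u (#⇒sq-pos p#0))
            (*-nonneg (pos⇒nonneg 0<α) (energy-nonneg G p))
      ... | inj₂ αl#0 = nonneg+pos
            (sum-nonneg _ squares-nonneg)
            (*-pos 0<α (lap#0⇒energy-pos G p u (*-#0ʳ αl#0)))

  resolvent : ∀ (G : Multigraph n) {α} → 0# < α → ∃[ Q ] IsResolvent G α Q × IsSymmetric Q
  resolvent [] {α} 0<α = I , (λ i j → trans (+-congˡ (zeroʳ α)) (+-identityʳ _)) , I-sym
  resolvent (e ∷ G) {α} 0<α with resolvent G 0<α
  ... | Q , Q-res , Q-sym = Q′ , Q′-res , Q′-sym
    where
    open Resolvent G α Q Q-res
    w = weight e
    u = end₁ e
    v = end₂ e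
    p = potential u v
    s = drop u v
    b = α * w

    pivot-pos : 0# < 1# + b * s
    pivot-pos = pos+nonneg 0<1 (pos⇒nonneg
      (*-pos (*-pos 0<α (weight-pos e)) (drop-pos 0<α (end₁≢end₂ e))))

    r = inv (1# + b * s) (pos⇒# pivot-pos)
    d = b * r

    d[1+bs]≈b : d * (1# + b * s) ≈ b
    d[1+bs]≈b = begin
      (b * r) * (1# + b * s)  ≈⟨ *-assoc b r _ ⟩
      b * (r * (1# + b * s))  ≈⟨ *-congˡ (*-comm r _) ⟩
      b * ((1# + b * s) * r)  ≈⟨ *-congˡ (inv-inverseʳ (1# + b * s) _) ⟩
      b * 1#                  ≈⟨ *-identityʳ b ⟩
      b                       ∎

    Q′ : Matrix _
    Q′ i k = Q i k - (d * p k) * p i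

    Q′-sym : IsSymmetric Q′
    Q′-sym i k = +-cong (Q-sym i k) (-‿cong
      (solve 3 (λ d x y → ((d :* x) :* y) := ((d :* y) :* x)) refl d (p k) (p i)))

    Q′-res : IsResolvent (e ∷ G) α Q′
    Q′-res i k = begin
      Q′ i k + α * (w * (x * (Q′ u k - Q′ v k)) + lap G (λ m → Q′ m k) i)
        ≈⟨ +-congˡ (*-congˡ (+-cong (*-congˡ (*-congˡ Q′-drop)) (lap-linear G (λ m → Q m k) p (d * p k) i))) ⟩
      (Q i k - (d * p k) * p i) + α * (w * (x * (p k - (d * p k) * s)) + (lQ - (d * p k) * lp))
        ≈⟨ solve 10 (λ q d pk pi α w x s lQ lp →
             ((q :- ((d :* pk) :* pi)) :+ (α :* ((w :* (x :* (pk :- ((d :* pk) :* s)))) :+ (lQ :- ((d :* pk) :* lp)))))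
             := ((q :+ (α :* lQ)) :+ (((x :* pk) :* ((α :* w) :- (d :* ((α :* w) :* s)))) :- ((d :* pk) :* (pi :+ (α :* lp))))))
             refl (Q i k) d (p k) (p i) α w x s lQ lp ⟩
      (Q i k + α * lQ) + ((x * p k) * (b - d * (b * s)) - (d * p k) * (p i + α * lp))
        ≈⟨ +-cong (Q-res i k) (+-cong (*-congˡ b-dbs≈d) (-‿cong (*-congˡ (potential-eq u v i)))) ⟩
      I i k + ((x * p k) * d - (d * p k) * x)
        ≈⟨ solve 4 (λ i x p d → (i :+ (((x :* p) :* d) :- ((d :* p) :* x))) := i) refl (I i k) x (p k) d ⟩
      I i k ∎
      where
      x = χ u v i
      lQ = lap G (λ m → Q m k) i
      lp = lap G p i

      b-dbs≈d : b - d * (b * s) ≈ d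
      b-dbs≈d = begin
        b - d * (b * s)                   ≈⟨ +-congʳ d[1+bs]≈b ⟨
        d * (1# + b * s) - d * (b * s)    ≈⟨ solve 3 (λ d o t → ((d :* (o :+ t)) :- (d :* t)) := (d :* o)) refl d 1# (b * s) ⟩
        d * 1#                            ≈⟨ *-identityʳ d ⟩
        d                                 ∎

      Q′-drop : Q′ u k - Q′ v k ≈ p k - (d * p k) * s
      Q′-drop = begin
        (Q u k - (d * p k) * p u) - (Q v k - (d * p k) * p v)
          ≈⟨ solve 5 (λ qu qv c pu pv →
               ((qu :- (c :* pu)) :- (qv :- (c :* pv))) := ((qu :- qv) :- (c :* (pu :- pv))))
               refl (Q u k) (Q v k) (d * p k) (p u) (p v) ⟩
        (Q u k - Q v k) - (d * p k) * s
          ≈⟨ +-congʳ (+-cong (Q-sym u k) (-‿cong (Q-sym v k))) ⟩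
        p k - (d * p k) * s ∎

  1+0 : ∀ {a b} → a ≈ 1# → b ≈ 0# → a + b ≈ 1#
  1+0 a≈1 b≈0 = trans (+-cong a≈1 b≈0) (+-identityʳ 1#)

  0+1 : ∀ {a b} → a ≈ 0# → b ≈ 1# → a + b ≈ 1#
  0+1 a≈0 b≈1 = trans (+-cong a≈0 b≈1) (+-identityˡ 1#)

  joins : Edge n → Matrix n
  joins e i k = I i (end₁ e) * I k (end₂ e) + I i (end₂ e) * I k (end₁ e)

  I*I≈1 : (i k : Fin n) → I i i * I k k ≈ 1#
  I*I≈1 i k = trans (*-cong (I-diag i) (I-diag k)) (*-identityˡ 1#)

  I*I≈0 : (i k u v : Fin n) → ¬ (i ≡ u × k ≡ v) → I i u * I k v ≈ 0#
  I*I≈0 i k u v ¬eq with i ≟ u | k ≟ v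
  ... | yes i≡u | yes k≡v = contradiction (i≡u , k≡v) ¬eq
  ... | yes _   | no  _   = zeroʳ 1#
  ... | no  _   | yes _   = zeroˡ 1#
  ... | no  _   | no  _   = zeroˡ 0#

  joins-yes : ∀ e {i k : Fin n} → Joins i k e → joins e i k ≈ 1#
  joins-yes e {i} {k} (inj₁ (≡.refl , ≡.refl)) =
    1+0 (I*I≈1 i k) (I*I≈0 i k k i λ (i≡k , _) → end₁≢end₂ e i≡k)
  joins-yes e {i} {k} (inj₂ (≡.refl , ≡.refl)) =
    0+1 (I*I≈0 i k k i λ (i≡k , _) → end₁≢end₂ e (≡.sym i≡k)) (I*I≈1 i k)

  joins-no : ∀ e {i k : Fin n} → ¬ Joins i k e → joins e i k ≈ 0#
  joins-no e {i} {k} ¬j = trans (+-cong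
    (I*I≈0 i k (end₁ e) (end₂ e) λ (i≡u , k≡v) → ¬j (inj₁ (≡.sym i≡u , ≡.sym k≡v)))
    (I*I≈0 i k (end₂ e) (end₁ e) λ (i≡v , k≡u) → ¬j (inj₂ (≡.sym k≡u , ≡.sym i≡v))))
    (+-identityˡ 0#)

  ¬loop : ∀ e {i : Fin n} → ¬ Joins i i e
  ¬loop e (inj₁ (u≡i , v≡i)) = end₁≢end₂ e (≡.trans u≡i (≡.sym v≡i))
  ¬loop e (inj₂ (u≡i , v≡i)) = end₁≢end₂ e (≡.trans u≡i (≡.sym v≡i))

  ε-cons : ∀ e (G : Multigraph n) i k → ε (e ∷ G) i k ≈ weight e * joins e i k + ε G i k
  ε-cons e G i k = by-cases (joins? i k e)
    where
    by-cases : Dec (Joins i k e) → ε (e ∷ G) i k ≈ weight e * joins e i k + ε G i k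
    by-cases (yes j) = trans
      (reflexive (≡.cong totalWeight (filter-accept (joins? i k) {xs = G} j)))
      (+-congʳ (sym (trans (*-congˡ (joins-yes e j)) (*-identityʳ _))))
    by-cases (no ¬j) = trans
      (reflexive (≡.cong totalWeight (filter-reject (joins? i k) {xs = G} ¬j)))
      (sym (trans (+-congʳ (trans (*-congˡ (joins-no e ¬j)) (zeroʳ _))) (+-identityˡ _)))

  offDiagonal-cons : ∀ e (G : Multigraph n) i k →
    offDiagonal (e ∷ G) i k ≈ - (weight e * joins e i k) + offDiagonal G i k
  offDiagonal-cons e G i k with i ≟ k
  ... | yes ≡.refl = sym (trans (+-identityʳ _) (trans (-‿cong w*joins≈0) -0#≈0#))
    where
    w*joins≈0 : weight e * joins e i i ≈ 0#
    w*joins≈0 = trans (*-congˡ (joins-no e {i} {i} (¬loop e))) (zeroʳ _)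
  ... | no  _      = trans (-‿cong (ε-cons e G i k))
        (solve 2 (λ a b → (:- (a :+ b)) := ((:- a) :+ (:- b))) refl (weight e * joins e i k) (ε G i k))

  sum-offDiagonal : ∀ (G : Multigraph n) (y : Fin n → Carrier) i →
    ∑[ k < n ] (offDiagonal G i k * (y k - y i)) ≈ lap G y i
  sum-offDiagonal {n} [] y i = trans (sum-cong-≋ zero-term) (sum-replicate-zero n)
    where
    zero-term : ∀ k → offDiagonal [] i k * (y k - y i) ≈ 0#
    zero-term k with i ≟ k
    ... | yes _ = zeroˡ _
    ... | no  _ = trans (*-congʳ -0#≈0#) (zeroˡ _)
  sum-offDiagonal {n} (e ∷ G) y i = begin
    ∑[ k < n ] (offDiagonal (e ∷ G) i k * z k)
      ≈⟨ sum-cong-≋ (λ k → trans (*-congʳ (offDiagonal-cons e G i k))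
           (solve 7 (λ w iu iv ku kv o z →
             (((:- (w :* ((iu :* kv) :+ (iv :* ku)))) :+ o) :* z)
             := (((((:- (w :* iu)) :* kv) :+ ((:- (w :* iv)) :* ku)) :* z) :+ (o :* z)))
             refl w (I i u) (I i v) (I k u) (I k v) (offDiagonal G i k) (z k))) ⟩
    ∑[ k < n ] ((- (w * I i u) * I k v + - (w * I i v) * I k u) * z k + offDiagonal G i k * z k)
      ≈⟨ ∑-distrib-+ (λ k → (- (w * I i u) * I k v + - (w * I i v) * I k u) * z k) (λ k → offDiagonal G i k * z k) ⟩
    ∑[ k < n ] ((- (w * I i u) * I k v + - (w * I i v) * I k u) * z k) + ∑[ k < n ] (offDiagonal G i k * z k)
      ≈⟨ +-cong (sum-I₂ v u (- (w * I i u)) (- (w * I i v)) z) (sum-offDiagonal G y i) ⟩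
    (- (w * I i u) * (y v - y i) + - (w * I i v) * (y u - y i)) + lap G y i
      ≈⟨ +-congʳ (solve 6 (λ w iu iv yu yv yi →
           (((:- (w :* iu)) :* (yv :- yi)) :+ ((:- (w :* iv)) :* (yu :- yi)))
           := (w :* (((iu :* yi) :- (iu :* yv)) :+ ((iv :* yi) :- (iv :* yu)))))
           refl w (I i u) (I i v) (y u) (y v) (y i)) ⟩
    w * ((I i u * y i - I i u * y v) + (I i v * y i - I i v * y u)) + lap G y i
      ≈⟨ +-congʳ (*-congˡ (+-cong (+-congʳ (I-* i u y)) (+-congʳ (I-* i v y)))) ⟩
    w * ((I i u * y u - I i u * y v) + (I i v * y v - I i v * y u)) + lap G y i
      ≈⟨ +-congʳ (solve 5 (λ w iu iv yu yv →
           (w :* (((iu :* yu) :- (iu :* yv)) :+ ((iv :* yv) :- (iv :* yu))))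
           := (w :* ((iu :- iv) :* (yu :- yv))))
           refl w (I i u) (I i v) (y u) (y v)) ⟩
    w * (χ u v i * (y u - y v)) + lap G y i ∎
    where
    w = weight e
    u = end₁ e
    v = end₂ e
    z : Fin n → Carrier
    z k = y k - y i

  laplacian-lap : ∀ (G : Multigraph n) (y : Fin n → Carrier) i →
    ∑[ k < n ] (laplacian G i k * y k) ≈ lap G y i
  laplacian-lap {n} G y i = begin
    ∑[ k < n ] (laplacian G i k * y k)
      ≈⟨ sum-cong-≋ (λ k → trans (*-congʳ (entry k))
           (solve 5 (λ o ki S yk yi → ((o :- (ki :* S)) :* yk)
             := ((o :* (yk :- yi)) :+ ((o :* yi) :- (ki :* (S :* yk)))))
             refl (off k) (I k i) S (y k) (y i))) ⟩
    ∑[ k < n ] (off k * (y k - y i) + (off k * y i - I k i * (S * y k)))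
      ≈⟨ ∑-distrib-+ (λ k → off k * (y k - y i)) (λ k → off k * y i - I k i * (S * y k)) ⟩
    ∑[ k < n ] (off k * (y k - y i)) + ∑[ k < n ] (off k * y i - I k i * (S * y k))
      ≈⟨ +-cong (sum-offDiagonal G y i) rest≈0 ⟩
    lap G y i + 0#
      ≈⟨ +-identityʳ _ ⟩
    lap G y i ∎
    where
    off : Fin n → Carrier
    off = offDiagonal G i

    S : Carrier
    S = ∑[ k < n ] off k

    entry : ∀ k → laplacian G i k ≈ off k - I k i * S
    entry k = trans entry′ (+-congˡ (-‿cong (*-congʳ (I-sym i k))))
      where
      entry′ : laplacian G i k ≈ off k - I i k * S
      entry′ with i ≟ k
      ... | yes _ = sym (trans (+-identityˡ _) (-‿cong (*-identityˡ S)))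
      ... | no  _ = sym (trans (+-congˡ (trans (-‿cong (zeroˡ S)) -0#≈0#)) (+-identityʳ _))

    rest≈0 : ∑[ k < n ] (off k * y i - I k i * (S * y k)) ≈ 0#
    rest≈0 = begin
      ∑[ k < n ] (off k * y i - I k i * (S * y k))
        ≈⟨ sum-cong-≋ (λ k → +-congˡ (solve 3 (λ a b c → (:- (a :* (b :* c))) := (a :* ((:- b) :* c))) refl (I k i) S (y k))) ⟩
      ∑[ k < n ] (off k * y i + I k i * (- S * y k))
        ≈⟨ ∑-distrib-+ (λ k → off k * y i) (λ k → I k i * (- S * y k)) ⟩
      ∑[ k < n ] (off k * y i) + ∑[ k < n ] (I k i * (- S * y k))
        ≈⟨ +-cong (sym (*-distribʳ-sum (y i) off)) (sum-I i (λ k → - S * y k)) ⟩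
      S * y i + - S * y i
        ≈⟨ solve 2 (λ s y → ((s :* y) :+ ((:- s) :* y)) := (s :- s)) refl S (y i) ⟩
      S - S
        ≈⟨ -‿inverseʳ S ⟩
      0# ∎

  ⊞-lap : ∀ (G : Multigraph n) α (y : Fin n → Carrier) i →
    ∑[ k < n ] ((I ⊞ α ⊡ laplacian G) i k * y k) ≈ y i + α * lap G y i
  ⊞-lap {n} G α y i = begin
    ∑[ k < n ] ((I i k + α * laplacian G i k) * y k)
      ≈⟨ sum-cong-≋ (λ k → trans (*-congʳ (+-congʳ (I-sym i k)))
           (solve 4 (λ i α l y → ((i :+ (α :* l)) :* y) := ((i :* y) :+ (α :* (l :* y))))
             refl (I k i) α (laplacian G i k) (y k))) ⟩
    ∑[ k < n ] (I k i * y k + α * (laplacian G i k * y k))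
      ≈⟨ ∑-distrib-+ (λ k → I k i * y k) (λ k → α * (laplacian G i k * y k)) ⟩
    ∑[ k < n ] (I k i * y k) + ∑[ k < n ] (α * (laplacian G i k * y k))
      ≈⟨ +-cong (sum-I i y) (trans (sym (*-distribˡ-sum α (λ k → laplacian G i k * y k))) (*-congˡ (laplacian-lap G y i))) ⟩
    y i + α * lap G y i ∎

  ε-sym : ∀ (G : Multigraph n) → IsSymmetric (ε G)
  ε-sym []      i j = refl
  ε-sym (e ∷ G) i j = begin
    ε (e ∷ G) i j                    ≈⟨ ε-cons e G i j ⟩
    weight e * joins e i j + ε G i j ≈⟨ +-cong (*-congˡ joins-sym) (ε-sym G i j) ⟩
    weight e * joins e j i + ε G j i ≈⟨ ε-cons e G j i ⟨
    ε (e ∷ G) j i                    ∎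
    where
    joins-sym : joins e i j ≈ joins e j i
    joins-sym = solve 4 (λ a b c d → ((a :* b) :+ (c :* d)) := ((d :* c) :+ (b :* a))) refl _ _ _ _

  laplacian-sym : ∀ (G : Multigraph n) → IsSymmetric (laplacian G)
  laplacian-sym G i j with i ≟ j | j ≟ i
  ... | yes ≡.refl | yes _   = refl
  ... | no  _      | no  _   = -‿cong (ε-sym G i j)
  ... | yes i≡j    | no  j≢i = contradiction (≡.sym i≡j) j≢i
  ... | no  i≢j    | yes j≡i = contradiction (≡.sym j≡i) i≢j

  abstract
    I+αL-invertible : ∀ (G : Multigraph n) {α} → 0# < α →
      Invertible I _⊗_ (I ⊞ α ⊡ laplacian G)
    I+αL-invertible {n} G {α} 0<α with resolvent G 0<α
    ... | Q , Q-res , Q-sym = Q , left , right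
      where
      M : Matrix n
      M = I ⊞ α ⊡ laplacian G

      M-sym : IsSymmetric M
      M-sym i j = +-cong (I-sym i j) (*-congˡ (laplacian-sym G i j))

      right : M ⊗ Q ≋ I
      right i j = trans (⊞-lap G α (λ k → Q k j) i) (Q-res i j)

      left : Q ⊗ M ≋ I
      left i j = begin
        ∑[ k < n ] (Q i k * M k j)  ≈⟨ sum-cong-≋ (λ k → trans (*-comm _ _) (*-cong (M-sym k j) (Q-sym i k))) ⟩
        ∑[ k < n ] (M j k * Q k i)  ≈⟨ right j i ⟩
        I j i                       ≈⟨ I-sym j i ⟩
        I i j                       ∎

  -- Q is the relative forest accessibility matrix (I + αL)⁻¹, ρ the adjusted
  -- forest distance and θ = ρ_ij⁻¹ - (2α)⁻¹ the cumulative weight of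
  -- connections.

  Q : (G : Multigraph n) {α : Carrier} → 0# < α → Matrix n
  Q G 0<α = proj₁ (I+αL-invertible G 0<α)

  ρ : (G : Multigraph n) {α : Carrier} → 0# < α → Matrix n
  ρ G {α} 0<α i j = α * (q i i + q j j - q i j - q j i)
    where q = Q G 0<α

  ρ-pos : ∀ (G : Multigraph n) {α} (0<α : 0# < α) {i j} → i ≢ j → 0# < ρ G 0<α i j
  ρ-pos G {α} 0<α {i} {j} i≢j = *-pos 0<α (<-respʳ-≈ eq (drop-pos 0<α i≢j))
    where
    q = Q G 0<α

    q-res : IsResolvent G α q
    q-res i j = trans (sym (⊞-lap G α (λ k → q k j) i)) (proj₂ (proj₂ (I+αL-invertible G 0<α)) i j)

    open Resolvent G α q q-res

    eq : drop i j ≈ q i i + q j j - q i j - q j i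
    eq = solve 4 (λ ii jj ij ji → ((ii :- ij) :- (ji :- jj)) := (((ii :+ jj) :- ij) :- ji))
           refl (q i i) (q j j) (q i j) (q j i)

  2α-pos : ∀ {α} → 0# < α → 0# < (1# + 1#) * α
  2α-pos = *-pos (pos+nonneg 0<1 (pos⇒nonneg 0<1))

  θ : (G : Multigraph n) {α : Carrier} → 0# < α → {i j : Fin n} → i ≢ j → Carrier
  θ G {α} 0<α {i} {j} i≢j =
    inv (ρ G 0<α i j) (pos⇒# (ρ-pos G 0<α i≢j)) - inv ((1# + 1#) * α) (pos⇒# (2α-pos 0<α))

{-# OPTIONS --safe #-}

-- Let p solve (I + αL) p = e_i - e_j and put s = p_i - p_j, so that ρ_ij = α s.
-- Removing the edges between i and j subtracts the rank-one term
-- ε_ij (e_i - e_j)(e_i - e_j)ᵀ from L; pairing p with its counterpart p⁰ and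
-- using the symmetry of I + αL⁰ gives s = (1 - αε_ij s) s⁰, which is part 1.
-- Since s = pᵀ(I + αL)p, we have
--   2s - s² = (p_i + p_j)² + 2 (Σ_{k ≠ i,j} p_k² + α pᵀLp) ≥ 0,
-- and θ_ij is a positive multiple of 2s - s²; for G without the edges between
-- i and j this is part 2.  If an edge joins u ∈ {i, j} to v ∉ {i, j}, then
-- p_i + p_j, p_v and p_u - p_v cannot all vanish, so θ⁰_ij > 0; if there is no
-- such edge, then L⁰ (e_i - e_j) = 0 and s⁰ = 2.

module Submission where

open import Defs
open import Algebra.Bundles using (CommutativeRing)
import Algebra.Properties.Semiring.Sum as SemiringSum
open import Data.Fin.Base using (Fin)
open import Data.Fin.Properties using (_≟_)
open import Data.List.Base using ([]; _∷_)
open import Data.List.Membership.Propositional using (_∈_)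
open import Data.List.Membership.Propositional.Properties using (∈-filter⁺; ∈-filter⁻)
open import Data.List.Properties using (filter-accept; filter-reject)
open import Data.List.Relation.Unary.Any using (here; there)
open import Data.Nat.Base using (ℕ)
open import Data.Product.Base using (Σ; _×_; _,_; proj₂)
open import Data.Sum.Base using (_⊎_; inj₁; inj₂; swap)
open import Function.Base using (_∘_)
open import Function.Bundles using (_⇔_; mk⇔)
open import Level using (_⊔_)
open import Relation.Binary.PropositionalEquality.Core as ≡ using (_≡_; _≢_)
import Relation.Binary.Reasoning.Setoid as SetoidReasoning
open import Relation.Nullary.Decidable.Core using (Dec; yes; no; ¬?; _⊎-dec_)
open import Relation.Nullary.Negation.Core using (¬_; contradiction)

module ForestProperties {c ℓ₁ ℓ₂ ℓ₃} (F : OrderedField c ℓ₁ ℓ₂ ℓ₃) where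
  open OrderedField F hiding (zero)
  open CommutativeRing commutativeRing using (semiring)
  open OrderedFieldProperties F
  open IntegerSolver commutativeRing
  open SemiringSum semiring
  open Forest F
  open SetoidReasoning setoid

  private
    variable
      n : ℕ

  -- Signs and inverses in the ordered field.

  0≤0 : 0# ≤ 0#
  0≤0 = <-irrefl refl

  -- The number `x` is the product of `- 1#` and `- x`, and a factor of a product apart from zero is
  -- itself apart from zero.
  -‿#0 : ∀ {x} → x # 0# → - x # 0#
  -‿#0 {x} x#0 = *-#0ʳ {x = - 1#} (#-cong (sym -1*-x≈x) x#0)
    where
    -1*-x≈x : - 1# * - x ≈ x
    -1*-x≈x = trans (solve 2 (λ o x → ((:- o) :* (:- x)) := (o :* x)) refl 1# x) (*-identityˡ x)

  inv-#0 : ∀ x (x#0 : x # 0#) → inv x x#0 # 0#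
  inv-#0 x x#0 = *-#0ʳ (#-cong (sym (inv-inverseʳ x x#0)) (pos⇒# 0<1))

  -- The inverse equals `x` times its own square, a product of positive numbers.
  inv-pos : ∀ x (x#0 : x # 0#) → 0# < x → 0# < inv x x#0
  inv-pos x x#0 0<x = <-respʳ-≈ eq (*-pos 0<x (#⇒sq-pos (inv-#0 x x#0)))
    where
    r = inv x x#0
    eq : x * (r * r) ≈ r
    eq = begin
      x * (r * r)  ≈⟨ *-assoc x r r ⟨
      (x * r) * r  ≈⟨ *-congʳ (inv-inverseʳ x x#0) ⟩
      1# * r       ≈⟨ *-identityˡ r ⟩
      r            ∎

  *-cancel-inverse : ∀ {a b} c → a * b ≈ 1# → (a * b) * c ≈ c
  *-cancel-inverse c ab≈1 = trans (*-congʳ ab≈1) (*-identityˡ c)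

  -- The last hypothesis rearranges to `y ≈ x + b * (x * y)`; dividing by `x * y` gives the claim.
  x≈[1-bx]y⇒1/x≈1/y+b : ∀ {x y b r t} → x * r ≈ 1# → y * t ≈ 1# →
    x ≈ (1# - b * x) * y → r ≈ t + b
  x≈[1-bx]y⇒1/x≈1/y+b {x} {y} {b} {r} {t} xr≈1 yt≈1 x≈ = begin
    r
      ≈⟨ *-cancel-inverse r yt≈1 ⟨
    (y * t) * r
      ≈⟨ *-congʳ (*-congʳ y≈) ⟩
    ((x + b * (x * y)) * t) * r
      ≈⟨ solve 5 (λ x y r t b → (((x :+ (b :* (x :* y))) :* t) :* r)
           := (((x :* r) :* t) :+ ((x :* r) :* ((y :* t) :* b)))) refl x y r t b ⟩
    (x * r) * t + (x * r) * ((y * t) * b)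
      ≈⟨ +-cong (*-cancel-inverse t xr≈1)
           (trans (*-cancel-inverse _ xr≈1) (*-cancel-inverse b yt≈1)) ⟩
    t + b ∎
    where
    y≈ : y ≈ x + b * (x * y)
    y≈ = begin
      y
        ≈⟨ *-identityˡ y ⟨
      1# * y
        ≈⟨ solve 4 (λ o x y b → (o :* y) := (((o :- (b :* x)) :* y) :+ (b :* (x :* y)))) refl 1# x y b ⟩
      (1# - b * x) * y + b * (x * y)
        ≈⟨ +-congʳ x≈ ⟨
      x + b * (x * y) ∎

  +-−-congʳ : ∀ {x y z} a → x ≈ y + z → x - a ≈ (y - a) + z
  +-−-congʳ {x} {y} {z} a x≈y+z = trans (+-congʳ x≈y+z)
    (solve 3 (λ y z a → ((y :+ z) :- a) := ((y :- a) :+ z)) refl y z a)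

  -- The complement of a pair of vertices, and the vector e_u - e_v.

  -- For `u ≢ v` this is the indicator of the vertices other than `u` and `v`. As a ring expression
  -- in `I` it lets a sum be split by `sum-I`.
  outside : Fin n → Fin n → Fin n → Carrier
  outside u v k = 1# - (I k u + I k v)

  outside-nonneg : {u v : Fin n} → u ≢ v → ∀ k → 0# ≤ outside u v k
  outside-nonneg {u = u} {v} u≢v k with k ≟ u | k ≟ v
  ... | yes k≡u | yes k≡v = contradiction (≡.trans (≡.sym k≡u) k≡v) u≢v
  ... | yes _   | no  _   = λ lt → 0≤0 (<-respˡ-≈ (trans (+-congˡ (-‿cong (+-identityʳ 1#))) (-‿inverseʳ 1#)) lt)
  ... | no  _   | yes _   = λ lt → 0≤0 (<-respˡ-≈ (trans (+-congˡ (-‿cong (+-identityˡ 1#))) (-‿inverseʳ 1#)) lt)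
  ... | no  _   | no  _   = λ lt → pos⇒nonneg 0<1
        (<-respˡ-≈ (trans (+-congˡ (-‿cong (+-identityˡ 0#))) (x-0≈x 1#)) lt)

  outside≈1 : {u v k : Fin n} → k ≢ u → k ≢ v → outside u v k ≈ 1#
  outside≈1 k≢u k≢v =
    trans (+-congˡ (-‿cong (trans (+-cong (I-off k≢u) (I-off k≢v)) (+-identityˡ 0#)))) (x-0≈x 1#)

  sum-outside : (u v : Fin n) (y : Fin n → Carrier) →
    sum y ≈ (y u + y v) + ∑[ k < n ] (outside u v k * y k)
  sum-outside {n} u v y = begin
    ∑[ k < n ] y k
      ≈⟨ sum-cong-≋ (λ k → trans (sym (*-identityˡ _)) (solve 4 (λ o a b y →
           (o :* y) := ((a :* y) :+ ((b :* y) :+ ((o :- (a :+ b)) :* y)))) refl 1# (I k u) (I k v) (y k))) ⟩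
    ∑[ k < n ] (I k u * y k + (I k v * y k + outside u v k * y k))
      ≈⟨ ∑-distrib-+ (λ k → I k u * y k) (λ k → I k v * y k + outside u v k * y k) ⟩
    ∑[ k < n ] (I k u * y k) + ∑[ k < n ] (I k v * y k + outside u v k * y k)
      ≈⟨ +-cong (sum-I u y) (trans (∑-distrib-+ (λ k → I k v * y k) (λ k → outside u v k * y k))
           (+-congʳ (sum-I v y))) ⟩
    y u + (y v + ∑[ k < n ] (outside u v k * y k))
      ≈⟨ +-assoc _ _ _ ⟨
    (y u + y v) + ∑[ k < n ] (outside u v k * y k) ∎

  χ-outside : {u v k : Fin n} → k ≢ u → k ≢ v → χ u v k ≈ 0#
  χ-outside k≢u k≢v = trans (+-cong (I-off k≢u) (-‿cong (I-off k≢v))) (-‿inverseʳ 0#)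

  χ-drop : {u v : Fin n} → u ≢ v → χ u v u - χ u v v ≈ 1# + 1#
  χ-drop {u = u} {v} u≢v = begin
    (I u u - I u v) - (I v u - I v v)
      ≈⟨ +-cong (+-cong (I-diag u) (-‿cong (I-off u≢v)))
           (-‿cong (+-cong (I-off (u≢v ∘ ≡.sym)) (-‿cong (I-diag v)))) ⟩
    (1# - 0#) - (0# - 1#)
      ≈⟨ solve 2 (λ o z → ((o :- z) :- (z :- o)) := ((o :- z) :+ (o :- z))) refl 1# 0# ⟩
    (1# - 0#) + (1# - 0#)
      ≈⟨ +-cong (x-0≈x 1#) (x-0≈x 1#) ⟩
    1# + 1# ∎

  -- Symmetry of the Laplacian and of I + αL.

  -- This exhibits the contribution of one edge to the bilinear form of the Laplacian as an
  -- expression symmetric in `y` and `z`, so that self-adjointness follows by induction over the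
  -- edges.
  sum-*-lap-∷ : ∀ e (G : Multigraph n) (y z : Fin n → Carrier) →
    ∑[ k < n ] (y k * lap (e ∷ G) z k) ≈
    weight e * ((y (end₁ e) - y (end₂ e)) * (z (end₁ e) - z (end₂ e))) + ∑[ k < n ] (y k * lap G z k)
  sum-*-lap-∷ {n} e G y z = begin
    ∑[ k < n ] (y k * (w * (χ u v k * d) + lap G z k))
      ≈⟨ sum-cong-≋ (λ k → solve 5 (λ y w χ d l →
           (y :* ((w :* (χ :* d)) :+ l)) := (((w :* d) :* (y :* χ)) :+ (y :* l)))
           refl (y k) w (χ u v k) d (lap G z k)) ⟩
    ∑[ k < n ] ((w * d) * (y k * χ u v k) + y k * lap G z k)
      ≈⟨ ∑-distrib-+ (λ k → (w * d) * (y k * χ u v k)) (λ k → y k * lap G z k) ⟩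
    ∑[ k < n ] ((w * d) * (y k * χ u v k)) + ∑[ k < n ] (y k * lap G z k)
      ≈⟨ +-congʳ (*-distribˡ-sum (w * d) (λ k → y k * χ u v k)) ⟨
    (w * d) * (∑[ k < n ] (y k * χ u v k)) + ∑[ k < n ] (y k * lap G z k)
      ≈⟨ +-congʳ (trans (*-congˡ (sum-χ u v y))
           (trans (*-assoc w d _) (*-congˡ (*-comm d _)))) ⟩
    w * ((y u - y v) * d) + ∑[ k < n ] (y k * lap G z k) ∎
    where
    w = weight e
    u = end₁ e
    v = end₂ e
    d = z u - z v

  lap-selfAdjoint : ∀ (G : Multigraph n) (y z : Fin n → Carrier) →
    ∑[ k < n ] (y k * lap G z k) ≈ ∑[ k < n ] (z k * lap G y k)
  lap-selfAdjoint []      y z = sum-cong-≋ (λ k → trans (zeroʳ (y k)) (sym (zeroʳ (z k))))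
  lap-selfAdjoint {n} (e ∷ G) y z = begin
    ∑[ k < n ] (y k * lap (e ∷ G) z k)
      ≈⟨ sum-*-lap-∷ e G y z ⟩
    weight e * (_ * _) + ∑[ k < n ] (y k * lap G z k)
      ≈⟨ +-cong (*-congˡ (*-comm _ _)) (lap-selfAdjoint G y z) ⟩
    weight e * (_ * _) + ∑[ k < n ] (z k * lap G y k)
      ≈⟨ sum-*-lap-∷ e G z y ⟨
    ∑[ k < n ] (z k * lap (e ∷ G) y k) ∎

  sum-*-[1+αlap] : ∀ (G : Multigraph n) α (y z : Fin n → Carrier) →
    ∑[ k < n ] (y k * (z k + α * lap G z k)) ≈
    ∑[ k < n ] (y k * z k) + α * (∑[ k < n ] (y k * lap G z k))
  sum-*-[1+αlap] {n} G α y z = begin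
    ∑[ k < n ] (y k * (z k + α * lap G z k))
      ≈⟨ sum-cong-≋ (λ k → solve 4 (λ y z α l →
           (y :* (z :+ (α :* l))) := ((y :* z) :+ (α :* (y :* l)))) refl (y k) (z k) α (lap G z k)) ⟩
    ∑[ k < n ] (y k * z k + α * (y k * lap G z k))
      ≈⟨ ∑-distrib-+ (λ k → y k * z k) (λ k → α * (y k * lap G z k)) ⟩
    ∑[ k < n ] (y k * z k) + ∑[ k < n ] (α * (y k * lap G z k))
      ≈⟨ +-congˡ (*-distribˡ-sum α (λ k → y k * lap G z k)) ⟨
    ∑[ k < n ] (y k * z k) + α * (∑[ k < n ] (y k * lap G z k)) ∎

  [1+αlap]-selfAdjoint : ∀ (G : Multigraph n) α (y z : Fin n → Carrier) →
    ∑[ k < n ] (y k * (z k + α * lap G z k)) ≈ ∑[ k < n ] (z k * (y k + α * lap G y k))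
  [1+αlap]-selfAdjoint {n} G α y z = begin
    ∑[ k < n ] (y k * (z k + α * lap G z k))
      ≈⟨ sum-*-[1+αlap] G α y z ⟩
    ∑[ k < n ] (y k * z k) + α * (∑[ k < n ] (y k * lap G z k))
      ≈⟨ +-cong (sum-cong-≋ (λ k → *-comm (y k) (z k))) (*-congˡ (lap-selfAdjoint G y z)) ⟩
    ∑[ k < n ] (z k * y k) + α * (∑[ k < n ] (z k * lap G y k))
      ≈⟨ sum-*-[1+αlap] G α z y ⟨
    ∑[ k < n ] (z k * (y k + α * lap G y k)) ∎

  -- Positivity of the energy, the kernel of the Laplacian, and the removal of edges.

  energy-pos : ∀ (G : Multigraph n) (y : Fin n → Carrier) {e u v} →
    e ∈ G → Joins u v e → y u - y v # 0# → 0# < energy G y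
  energy-pos (e ∷ G) y {u = u} {v} (here ≡.refl) e-joins d#0 =
    pos+nonneg (*-pos (weight-pos e) (sq-pos e-joins)) (energy-nonneg G y)
    where
    sq-pos : Joins u v e →
      0# < (y (end₁ e) - y (end₂ e)) * (y (end₁ e) - y (end₂ e))
    sq-pos (inj₁ (≡.refl , ≡.refl)) = #⇒sq-pos d#0
    sq-pos (inj₂ (≡.refl , ≡.refl)) = <-respʳ-≈
      (solve 2 (λ a b → ((a :- b) :* (a :- b)) := ((b :- a) :* (b :- a))) refl (y u) (y v))
      (#⇒sq-pos d#0)
  energy-pos (e ∷ G) y (there e∈G) e-joins d#0 =
    nonneg+pos (*-nonneg (pos⇒nonneg (weight-pos e)) (sq-nonneg _)) (energy-pos G y e∈G e-joins d#0)

  lap≈0 : ∀ (G : Multigraph n) (y : Fin n → Carrier) →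
    (∀ {e} → e ∈ G → y (end₁ e) - y (end₂ e) ≈ 0#) → ∀ k → lap G y k ≈ 0#
  lap≈0 []      y flat k = refl
  lap≈0 (e ∷ G) y flat k = begin
    weight e * (χ _ _ k * (y (end₁ e) - y (end₂ e))) + lap G y k
      ≈⟨ +-cong (*-congˡ (*-congˡ (flat (here ≡.refl)))) (lap≈0 G y (flat ∘ there) k) ⟩
    weight e * (χ (end₁ e) (end₂ e) k * 0#) + 0#
      ≈⟨ +-identityʳ _ ⟩
    weight e * (χ (end₁ e) (end₂ e) k * 0#)
      ≈⟨ trans (*-congˡ (zeroʳ _)) (zeroʳ _) ⟩
    0# ∎

  -- All edges between `i` and `j` contribute multiples of the same rank-one operator: exchanging
  -- the stored ends changes the sign of both factors. Their weights add up to `ε G i j`.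
  lap-removeEdges : ∀ (G : Multigraph n) i j (y : Fin n → Carrier) k →
    lap G y k ≈ lap (removeEdges G i j) y k + ε G i j * (χ i j k * (y i - y j))
  lap-removeEdges []      i j y k = sym (trans (+-congˡ (zeroˡ _)) (+-identityʳ 0#))
  lap-removeEdges (e ∷ G) i j y k = by-cases (joins? i j e)
    where
    w = weight e
    x = χ i j k
    d = y i - y j
    G⁰ = removeEdges G i j

    joined-term : Joins i j e → χ (end₁ e) (end₂ e) k * (y (end₁ e) - y (end₂ e)) ≈ x * d
    joined-term (inj₁ (≡.refl , ≡.refl)) = refl
    joined-term (inj₂ (≡.refl , ≡.refl)) =
      solve 4 (λ a b c d → ((a :- b) :* (c :- d)) := ((b :- a) :* (d :- c))) refl
        (I k j) (I k i) (y j) (y i)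

    by-cases : Dec (Joins i j e) →
      lap (e ∷ G) y k ≈ lap (removeEdges (e ∷ G) i j) y k + ε (e ∷ G) i j * (x * d)
    by-cases (yes e-joins) = begin
      lap (e ∷ G) y k
        ≈⟨ +-cong (*-congˡ (joined-term e-joins)) (lap-removeEdges G i j y k) ⟩
      w * (x * d) + (lap G⁰ y k + ε G i j * (x * d))
        ≈⟨ solve 4 (λ w t l ε → ((w :* t) :+ (l :+ (ε :* t))) := (l :+ ((w :+ ε) :* t)))
             refl w (x * d) (lap G⁰ y k) (ε G i j) ⟩
      lap G⁰ y k + (w + ε G i j) * (x * d)
        ≡⟨ ≡.cong₂ (λ H E → lap H y k + totalWeight E * (x * d))
             (filter-reject (¬? ∘ joins? i j) {xs = G} (contradiction e-joins))
             (filter-accept (joins? i j) {xs = G} e-joins) ⟨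
      lap (removeEdges (e ∷ G) i j) y k + ε (e ∷ G) i j * (x * d) ∎
    by-cases (no ¬e-joins) = begin
      lap (e ∷ G) y k
        ≈⟨ +-congˡ (lap-removeEdges G i j y k) ⟩
      _ + (lap G⁰ y k + ε G i j * (x * d))
        ≈⟨ +-assoc _ _ _ ⟨
      lap (e ∷ G⁰) y k + ε G i j * (x * d)
        ≡⟨ ≡.cong₂ (λ H E → lap H y k + totalWeight E * (x * d))
             (filter-accept (¬? ∘ joins? i j) {xs = G} ¬e-joins)
             (filter-reject (joins? i j) {xs = G} ¬e-joins) ⟨
      lap (removeEdges (e ∷ G) i j) y k + ε (e ∷ G) i j * (x * d) ∎

  -- Reciprocity, and the sign of 2s - s².

  module ResolventProperties (G : Multigraph n) (α : Carrier) (Q : Matrix n)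
    (Q-res : IsResolvent G α Q) where
    open Resolvent G α Q Q-res

    -- Pair `y` with the equation of the potential `p`, move I + αL over to `y` by symmetry, and
    -- insert the equation of `y`. It is applied below to the potential of another graph, and to `χ`
    -- itself with `a` equal to one.
    reciprocity : ∀ u v a (y : Fin n → Carrier) →
      (∀ k → y k + α * lap G y k ≈ a * χ u v k) → y u - y v ≈ a * drop u v
    reciprocity u v a y y-eq = begin
      y u - y v
        ≈⟨ sum-χ u v y ⟨
      ∑[ k < n ] (y k * χ u v k)
        ≈⟨ sum-cong-≋ (λ k → *-congˡ (potential-eq u v k)) ⟨
      ∑[ k < n ] (y k * (p k + α * lap G p k))
        ≈⟨ [1+αlap]-selfAdjoint G α y p ⟩
      ∑[ k < n ] (p k * (y k + α * lap G y k))
        ≈⟨ sum-cong-≋ (λ k → trans (*-congˡ (y-eq k))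
             (solve 3 (λ p a x → (p :* (a :* x)) := (a :* (p :* x))) refl (p k) a (χ u v k))) ⟩
      ∑[ k < n ] (a * (p k * χ u v k))
        ≈⟨ *-distribˡ-sum a (λ k → p k * χ u v k) ⟨
      a * (∑[ k < n ] (p k * χ u v k))
        ≈⟨ *-congˡ (sum-χ u v p) ⟩
      a * drop u v ∎
      where
      p = potential u v

    module Deficit (0<α : 0# < α) {u v : Fin n} (u≢v : u ≢ v) where
      p : Fin n → Carrier
      p = potential u v

      -- `R` is the sum of p_k² over the vertices other than `u` and `v`, and `E` is pᵀLp.
      s R E : Carrier
      s = drop u v
      R = ∑[ k < n ] (outside u v k * (p k * p k))
      E = energy G p

      deficit : Carrier
      deficit = (s + s) - s * s

      -- By `drop-eq`, s = p_u² + p_v² + R + αE. Doubling this and using 2a² + 2b² = (a + b)² + (a -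
      -- b)² leaves (p_u - p_v)², which is s².
      deficit-eq : deficit ≈ (p u + p v) * (p u + p v) + ((R + α * E) + (R + α * E))
      deficit-eq = begin
        (s + s) - s * s
          ≈⟨ +-congʳ (trans (+-cong s≈ s≈) 2s-eq) ⟩
        (((p u + p v) * (p u + p v) + ((R + α * E) + (R + α * E))) + s * s) - s * s
          ≈⟨ solve 2 (λ x y → ((x :+ y) :- y) := x) refl _ (s * s) ⟩
        (p u + p v) * (p u + p v) + ((R + α * E) + (R + α * E)) ∎
        where
        s≈ : s ≈ ((p u * p u + p v * p v) + R) + α * E
        s≈ = trans (drop-eq u v) (+-congʳ (sum-outside u v (λ k → p k * p k)))
        2s-eq : (((p u * p u + p v * p v) + R) + α * E) + (((p u * p u + p v * p v) + R) + α * E)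
          ≈ ((p u + p v) * (p u + p v) + ((R + α * E) + (R + α * E))) + s * s
        2s-eq = solve 4 (λ a b r t →
          (((((a :* a) :+ (b :* b)) :+ r) :+ t) :+ ((((a :* a) :+ (b :* b)) :+ r) :+ t))
          := ((((a :+ b) :* (a :+ b)) :+ ((r :+ t) :+ (r :+ t))) :+ ((a :- b) :* (a :- b)))) refl (p u) (p v) R (α * E)

      term-nonneg : ∀ k → 0# ≤ outside u v k * (p k * p k)
      term-nonneg k = *-nonneg (outside-nonneg u≢v k) (sq-nonneg (p k))

      R-nonneg : 0# ≤ R
      R-nonneg = sum-nonneg _ term-nonneg

      αE-nonneg : 0# ≤ α * E
      αE-nonneg = *-nonneg (pos⇒nonneg 0<α) (energy-nonneg G p)

      deficit-nonneg : 0# ≤ deficit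
      deficit-nonneg lt = +-nonneg (sq-nonneg _)
        (+-nonneg (+-nonneg R-nonneg αE-nonneg) (+-nonneg R-nonneg αE-nonneg)) (<-respˡ-≈ deficit-eq lt)

      -- The expression is `s` for `x ≡ u` and the negative of `s` for `x ≡ v`, and `s` is positive.
      p-#0 : ∀ {x} → x ≡ u ⊎ x ≡ v → (p x + p x) - (p u + p v) # 0#
      p-#0 (inj₁ ≡.refl) = #-cong
        (solve 3 (λ a b c → (a :- b) := ((c :+ a) :- (c :+ b))) refl (p u) (p v) (p u))
        (pos⇒# (drop-pos 0<α u≢v))
      p-#0 (inj₂ ≡.refl) = #-cong
        (solve 3 (λ a b c → (:- (a :- b)) := ((b :+ c) :- (a :+ c))) refl (p u) (p v) (p v))
        (-‿#0 (pos⇒# (drop-pos 0<α u≢v)))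

      -- The nonzero quantity of `p-#0` is 2(p_x - p_y) + 2p_y - (p_u + p_v), so one of the three
      -- summands is apart from zero. In `deficit-eq` the first makes the energy positive, the
      -- second makes `R` positive because `y` is outside the pair, and the third makes the leading
      -- square positive.
      deficit-pos : JoinedToOutside G u v → 0# < deficit
      deficit-pos (e , x , y , e∈G , e-joins , x∈uv , y≢u , y≢v) =
        <-respʳ-≈ (sym deficit-eq) (by-cases (+-#0 (#-cong regroup (p-#0 x∈uv))))
        where
        regroup : (p x + p x) - (p u + p v) ≈
          ((p x - p y) + (p x - p y) + (p y + p y)) + - (p u + p v)
        regroup = solve 3 (λ a b c → ((a :+ a) :- c) := ((((a :- b) :+ (a :- b)) :+ (b :+ b)) :+ (:- c)))
          refl (p x) (p y) (p u + p v)

        doubled : 0# < R + α * E →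
          0# < (p u + p v) * (p u + p v) + ((R + α * E) + (R + α * E))
        doubled lt = nonneg+pos (sq-nonneg _) (pos+nonneg lt (pos⇒nonneg lt))

        by-p-y : p y # 0# → 0# < R + α * E
        by-p-y py#0 = pos+nonneg (sum-pos _ term-nonneg y
          (<-respʳ-≈ (sym (trans (*-congʳ (outside≈1 y≢u y≢v)) (*-identityˡ _))) (#⇒sq-pos py#0)))
          αE-nonneg

        by-edge : p x - p y # 0# → 0# < R + α * E
        by-edge d#0 = nonneg+pos R-nonneg (*-pos 0<α (energy-pos G p e∈G e-joins d#0))

        same : ∀ {a} → a + a # 0# → a # 0#
        same a+a#0 with +-#0 a+a#0
        ... | inj₁ a#0 = a#0
        ... | inj₂ a#0 = a#0

        by-cases : (p x - p y) + (p x - p y) + (p y + p y) # 0# ⊎ - (p u + p v) # 0# →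
          0# < (p u + p v) * (p u + p v) + ((R + α * E) + (R + α * E))
        by-cases (inj₂ -c#0) = pos+nonneg
          (#⇒sq-pos (#-cong (solve 1 (λ c → (:- (:- c)) := c) refl (p u + p v)) (-‿#0 -c#0)))
          (+-nonneg (+-nonneg R-nonneg αE-nonneg) (+-nonneg R-nonneg αE-nonneg))
        by-cases (inj₁ a+b#0) with +-#0 a+b#0
        ... | inj₁ a#0 = doubled (by-edge (same a#0))
        ... | inj₂ b#0 = doubled (by-p-y (same b#0))

  -- From s to the distance ρ and the cumulative weight θ.

  module _ (G : Multigraph n) {α : Carrier} (0<α : 0# < α) where
    Q-isResolvent : IsResolvent G α (Q G 0<α)
    Q-isResolvent i j = trans (sym (⊞-lap G α (λ k → Q G 0<α k j) i))
      (proj₂ (proj₂ (I+αL-invertible G 0<α)) i j)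

    open Resolvent G α (Q G 0<α) Q-isResolvent public
    open ResolventProperties G α (Q G 0<α) Q-isResolvent public

    ρ≈α*drop : ∀ u v → ρ G 0<α u v ≈ α * drop u v
    ρ≈α*drop u v = *-congˡ (solve 4 (λ uu vv uv vu →
      (((uu :+ vv) :- uv) :- vu) := ((uu :- uv) :- (vu :- vv))) refl
      (q u u) (q v v) (q u v) (q v u))
      where
      q = Q G 0<α

  module _ {α : Carrier} (0<α : 0# < α) where
    h : Carrier
    h = inv ((1# + 1#) * α) (pos⇒# (2α-pos 0<α))

    module _ (G : Multigraph n) {u v : Fin n} (u≢v : u ≢ v) where
      open Deficit G 0<α 0<α u≢v using (s; deficit)

      ρ⁻¹ : Carrier
      ρ⁻¹ = inv (ρ G 0<α u v) (pos⇒# (ρ-pos G 0<α u≢v))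

      ρ-inverseʳ : ρ G 0<α u v * ρ⁻¹ ≈ 1#
      ρ-inverseʳ = inv-inverseʳ (ρ G 0<α u v) (pos⇒# (ρ-pos G 0<α u≢v))

      -- Since ρ = αs, this is 1 / (2αs²).
      scale : Carrier
      scale = ((α * ρ⁻¹) * (α * ρ⁻¹)) * h

      scale-pos : 0# < scale
      scale-pos = *-pos (*-pos αr-pos αr-pos) (inv-pos _ _ (2α-pos 0<α))
        where
        αr-pos : 0# < α * ρ⁻¹
        αr-pos = *-pos 0<α (inv-pos _ _ (ρ-pos G 0<α u≢v))

      -- In the expanded product, `s + s` contributes ρ⁻¹, because αs times ρ⁻¹ and 2α times `h` are
      -- both one; `s * s` contributes `h`, because αs times ρ⁻¹ occurs twice.
      θ≈scale*deficit : θ G 0<α u≢v ≈ scale * deficit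
      θ≈scale*deficit = sym (begin
        (((α * r) * (α * r)) * h) * ((s + s) - s * s)
          ≈⟨ solve 4 (λ α r h s →
               ((((α :* r) :* (α :* r)) :* h) :* ((s :+ s) :- (s :* s)))
               := ((((α :* s) :* r) :* (((α :+ α) :* h) :* r)) :- (((α :* s) :* r) :* (((α :* s) :* r) :* h))))
               refl α r h s ⟩
        ((α * s) * r) * (((α + α) * h) * r) - ((α * s) * r) * (((α * s) * r) * h)
          ≈⟨ +-cong (trans (*-cancel-inverse _ αsr≈1) (*-cancel-inverse r 2αh≈1))
               (-‿cong (trans (*-cancel-inverse _ αsr≈1) (*-cancel-inverse h αsr≈1))) ⟩
        r - h ∎)
        where
        r = ρ⁻¹
        αsr≈1 : (α * s) * r ≈ 1#
        αsr≈1 = trans (*-congʳ (sym (ρ≈α*drop G 0<α u v))) ρ-inverseʳ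
        2αh≈1 : (α + α) * h ≈ 1#
        2αh≈1 = trans (*-congʳ (sym (trans (distribʳ α 1# 1#) (+-cong (*-identityˡ α) (*-identityˡ α)))))
          (inv-inverseʳ _ _)

  θ-nonneg : ∀ (G : Multigraph n) {α} (0<α : 0# < α) {u v} (u≢v : u ≢ v) → 0# ≤ θ G 0<α u≢v
  θ-nonneg G 0<α u≢v lt = *-nonneg (pos⇒nonneg (scale-pos 0<α G u≢v))
    (Deficit.deficit-nonneg G 0<α 0<α u≢v) (<-respˡ-≈ (θ≈scale*deficit 0<α G u≢v) lt)

  θ-pos : ∀ (G : Multigraph n) {α} (0<α : 0# < α) {u v} (u≢v : u ≢ v) →
    JoinedToOutside G u v → 0# < θ G 0<α u≢v
  θ-pos G 0<α u≢v joined = <-respʳ-≈ (sym (θ≈scale*deficit 0<α G u≢v))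
    (*-pos (scale-pos 0<α G u≢v) (Deficit.deficit-pos G 0<α 0<α u≢v joined))

  drop≈2⇒θ≈0 : ∀ (G : Multigraph n) {α} (0<α : 0# < α) {u v} (u≢v : u ≢ v) →
    drop G 0<α u v ≈ 1# + 1# → θ G 0<α u≢v ≈ 0#
  drop≈2⇒θ≈0 G 0<α {u} {v} u≢v s≈2 = begin
    θ G 0<α u≢v
      ≈⟨ θ≈scale*deficit 0<α G u≢v ⟩
    scale 0<α G u≢v * ((s + s) - s * s)
      ≈⟨ *-congˡ (+-congˡ (-‿cong (*-congʳ s≈2))) ⟩
    scale 0<α G u≢v * ((s + s) - (1# + 1#) * s)
      ≈⟨ *-congˡ (+-congˡ (-‿cong (trans (distribʳ s 1# 1#) (+-cong (*-identityˡ s) (*-identityˡ s))))) ⟩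
    scale 0<α G u≢v * ((s + s) - (s + s))
      ≈⟨ trans (*-congˡ (-‿inverseʳ _)) (zeroʳ _) ⟩
    0# ∎
    where
    s = drop G 0<α u v

  -- The effect of a rank-one change of the Laplacian on ρ and θ.

  module RankOneUpdate (G G⁰ : Multigraph n) {α} (0<α : 0# < α) {i j} (i≢j : i ≢ j) (w : Carrier)
    (lap-eq : ∀ y k → lap G y k ≈ lap G⁰ y k + w * (χ i j k * (y i - y j))) where
    r = ρ⁻¹ 0<α G i≢j
    r⁰ = ρ⁻¹ 0<α G⁰ i≢j
    p = potential G 0<α i j
    s = drop G 0<α i j
    s⁰ = drop G⁰ 0<α i j

    -- In the equation of `p` for `G`, the rank-one term is the multiple `w * s` of `χ i j`. Moved
    -- to the right-hand side, it only rescales the source, so `p` solves an equation for `G⁰`.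
    p-eq : ∀ k → p k + α * lap G⁰ p k ≈ (1# - w * (α * s)) * χ i j k
    p-eq k = begin
      p k + α * lap G⁰ p k
        ≈⟨ solve 6 (λ p α l w s x →
             (p :+ (α :* l)) := ((p :+ (α :* (l :+ (w :* (x :* s))))) :- ((w :* (α :* s)) :* x)))
             refl (p k) α (lap G⁰ p k) w s x ⟩
      (p k + α * (lap G⁰ p k + w * (x * s))) - (w * (α * s)) * x
        ≈⟨ +-congʳ (+-congˡ (*-congˡ (lap-eq p k))) ⟨
      (p k + α * lap G p k) - (w * (α * s)) * x
        ≈⟨ +-congʳ (trans (potential-eq G 0<α i j k) (sym (*-identityˡ x))) ⟩
      1# * x - (w * (α * s)) * x
        ≈⟨ solve 3 (λ o b x → ((o :* x) :- (b :* x)) := ((o :- b) :* x)) refl 1# (w * (α * s)) x ⟩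
      (1# - w * (α * s)) * x ∎
      where
      x = χ i j k

    -- Reciprocity in `G⁰`, applied to the potential of `G`, compares `s` with `s⁰`; multiplying by
    -- α turns both into distances.
    ρ-eq : ρ G 0<α i j ≈ (1# - w * ρ G 0<α i j) * ρ G⁰ 0<α i j
    ρ-eq = begin
      ρ G 0<α i j
        ≈⟨ ρ≈α*drop G 0<α i j ⟩
      α * s
        ≈⟨ *-congˡ (reciprocity G⁰ 0<α i j (1# - w * (α * s)) p p-eq) ⟩
      α * ((1# - w * (α * s)) * s⁰)
        ≈⟨ solve 3 (λ α b s → (α :* (b :* s)) := (b :* (α :* s))) refl α (1# - w * (α * s)) s⁰ ⟩
      (1# - w * (α * s)) * (α * s⁰)
        ≈⟨ *-cong (+-congˡ (-‿cong (*-congˡ (ρ≈α*drop G 0<α i j)))) (ρ≈α*drop G⁰ 0<α i j) ⟨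
      (1# - w * ρ G 0<α i j) * ρ G⁰ 0<α i j ∎

    r≈r⁰+w : r ≈ r⁰ + w
    r≈r⁰+w = x≈[1-bx]y⇒1/x≈1/y+b (ρ-inverseʳ 0<α G i≢j) (ρ-inverseʳ 0<α G⁰ i≢j) ρ-eq

    θ-update : θ G 0<α i≢j ≈ θ G⁰ 0<α i≢j + w
    θ-update = +-−-congʳ {r} {r⁰} {w} (h 0<α) r≈r⁰+w

  -- Edges leaving the pair of vertices, and their behaviour under removal.

  joined-unique : ∀ {i j u v : Fin n} {e} → Joins i j e → Joins u v e → v ≡ i ⊎ v ≡ j
  joined-unique (inj₁ (_ , ≡.refl)) (inj₁ (_ , ≡.refl)) = inj₂ ≡.refl
  joined-unique (inj₁ (≡.refl , _)) (inj₂ (≡.refl , _)) = inj₁ ≡.refl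
  joined-unique (inj₂ (_ , ≡.refl)) (inj₁ (_ , ≡.refl)) = inj₁ ≡.refl
  joined-unique (inj₂ (≡.refl , _)) (inj₂ (≡.refl , _)) = inj₂ ≡.refl

  -- An edge with an end outside the pair does not join `i` and `j`, so the filter keeps it.
  JoinedToOutside-removeEdges : ∀ {G : Multigraph n} {i j} →
    JoinedToOutside G i j → JoinedToOutside (removeEdges G i j) i j
  JoinedToOutside-removeEdges {i = i} {j} (e , u , v , e∈G , e-joins , u∈ij , v≢i , v≢j) =
    e , u , v , ∈-filter⁺ (¬? ∘ joins? i j) e∈G ¬ij , e-joins , u∈ij , v≢i , v≢j
    where
    ¬ij : ¬ Joins i j e
    ¬ij ij with joined-unique {e = e} ij e-joins
    ... | inj₁ v≡i = v≢i v≡i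
    ... | inj₂ v≡j = v≢j v≡j

  -- Suppose `u` lies in the pair. If `v` does not, the edge leads outside; if `v` does, the edge is
  -- a loop or joins `i` and `j`. All of these are excluded.
  end-outside : ∀ {G : Multigraph n} {i j e u v} → ¬ JoinedToOutside G i j →
    e ∈ G → ¬ Joins i j e → Joins u v e → u ≢ i × u ≢ j
  end-outside {i = i} {j} {e} {u} {v} ¬joined e∈G ¬ij e-joins =
    (λ u≡i → absurd (inj₁ u≡i)) , (λ u≡j → absurd (inj₂ u≡j))
    where
    both : u ≡ i ⊎ u ≡ j → v ≡ i ⊎ v ≡ j → Joins i j e
    both (inj₁ ≡.refl) (inj₁ ≡.refl) = contradiction e-joins (¬loop e)
    both (inj₁ ≡.refl) (inj₂ ≡.refl) = e-joins
    both (inj₂ ≡.refl) (inj₁ ≡.refl) = swap e-joins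
    both (inj₂ ≡.refl) (inj₂ ≡.refl) = contradiction e-joins (¬loop e)

    absurd : ¬ (u ≡ i ⊎ u ≡ j)
    absurd u∈ij with (v ≟ i) ⊎-dec (v ≟ j)
    ... | yes v∈ij = ¬ij (both u∈ij v∈ij)
    ... | no  v∉ij = ¬joined (e , u , v , e∈G , e-joins , u∈ij , v∉ij ∘ inj₁ , v∉ij ∘ inj₂)

  -- Conversion checking of θ (removeEdges G i j) against itself, under two
  -- different openings of Forest, would unfold the proofs inside θ; a variable G⁰
  -- avoids this.
  record IsRemoval (G G⁰ : Multigraph n) (i j : Fin n) : Set (c ⊔ ℓ₁ ⊔ ℓ₃) where
    field
      lap-eq   : ∀ y k → lap G y k ≈ lap G⁰ y k + ε G i j * (χ i j k * (y i - y j))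
      joined⁰  : JoinedToOutside G i j → JoinedToOutside G⁰ i j
      ∈⁰⇒      : ∀ {e} → e ∈ G⁰ → e ∈ G × ¬ Joins i j e

  removeEdges-isRemoval : ∀ (G : Multigraph n) i j → IsRemoval G (removeEdges G i j) i j
  removeEdges-isRemoval G i j = record
    { lap-eq  = lap-removeEdges G i j
    ; joined⁰ = JoinedToOutside-removeEdges
    ; ∈⁰⇒     = ∈-filter⁻ (¬? ∘ joins? i j)
    }

  -- The three claims for a removal.

  module Removal {G G⁰ : Multigraph n} {i j} (isRemoval : IsRemoval G G⁰ i j)
    {α} (0<α : 0# < α) (i≢j : i ≢ j) where
    open IsRemoval isRemoval

    θ≈θ⁰+ε : θ G 0<α i≢j ≈ θ G⁰ 0<α i≢j + ε G i j
    θ≈θ⁰+ε = RankOneUpdate.θ-update G G⁰ 0<α i≢j (ε G i j) lap-eq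

    ε+θ⁰≈θ : ε G i j + θ G⁰ 0<α i≢j ≈ θ G 0<α i≢j
    ε+θ⁰≈θ = trans (+-comm _ _) (sym θ≈θ⁰+ε)

    ε≤θ : ε G i j ≤ θ G 0<α i≢j
    ε≤θ θ<ε = θ-nonneg G⁰ 0<α i≢j (x+y<x⇒y<0 (<-respˡ-≈ (sym ε+θ⁰≈θ) θ<ε))

    -- The edge leading outside survives in `G⁰`, so θ⁰ is positive and θ lies strictly above `ε`.
    θ≈ε⇒¬joined : θ G 0<α i≢j ≈ ε G i j → ¬ JoinedToOutside G i j
    θ≈ε⇒¬joined θ≈ε joined = <-irrefl (trans (+-identityʳ _) (trans (sym θ≈ε) (sym ε+θ⁰≈θ)))
      (+-monoʳ-< (ε G i j) (θ-pos G⁰ 0<α i≢j (joined⁰ joined)))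

    -- Here `χ i j` is fixed by I + αL⁰, so reciprocity identifies s⁰ with the drop of `χ i j`
    -- itself.
    ¬joined⇒drop⁰≈2 : ¬ JoinedToOutside G i j → drop G⁰ 0<α i j ≈ 1# + 1#
    ¬joined⇒drop⁰≈2 ¬joined = begin
      drop G⁰ 0<α i j         ≈⟨ *-identityˡ _ ⟨
      1# * drop G⁰ 0<α i j    ≈⟨ reciprocity G⁰ 0<α i j 1# (χ i j) χ-eq ⟨
      χ i j i - χ i j j       ≈⟨ χ-drop i≢j ⟩
      1# + 1#                 ∎
      where
      flat : ∀ {e} → e ∈ G⁰ → χ i j (end₁ e) - χ i j (end₂ e) ≈ 0#
      flat {e} e∈G⁰ with ∈⁰⇒ e∈G⁰
      ... | e∈G , ¬ij
        -- The two orientations of the edge give its two ends in turn; both lie outside the pair,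
        -- where `χ i j` vanishes.
        with end-outside ¬joined e∈G ¬ij (inj₁ (≡.refl , ≡.refl))
           | end-outside ¬joined e∈G ¬ij (inj₂ (≡.refl , ≡.refl))
      ... | u≢i , u≢j | v≢i , v≢j =
        trans (+-cong (χ-outside u≢i u≢j) (-‿cong (χ-outside v≢i v≢j))) (-‿inverseʳ 0#)

      χ-eq : ∀ k → χ i j k + α * lap G⁰ (χ i j) k ≈ 1# * χ i j k
      χ-eq k = begin
        χ i j k + α * lap G⁰ (χ i j) k  ≈⟨ +-congˡ (trans (*-congˡ (lap≈0 G⁰ (χ i j) flat k)) (zeroʳ α)) ⟩
        χ i j k + 0#                    ≈⟨ +-identityʳ _ ⟩
        χ i j k                         ≈⟨ *-identityˡ _ ⟨
        1# * χ i j k                    ∎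

    ¬joined⇒θ≈ε : ¬ JoinedToOutside G i j → θ G 0<α i≢j ≈ ε G i j
    ¬joined⇒θ≈ε ¬joined = begin
      θ G 0<α i≢j                 ≈⟨ θ≈θ⁰+ε ⟩
      θ G⁰ 0<α i≢j + ε G i j      ≈⟨ +-congʳ (drop≈2⇒θ≈0 G⁰ 0<α i≢j (¬joined⇒drop⁰≈2 ¬joined)) ⟩
      0# + ε G i j                ≈⟨ +-identityˡ _ ⟩
      ε G i j                     ∎

  -- The result type is written with Σ rather than _×_ so that it is unified with
  -- the expected type before the last argument is checked: G⁰ then becomes the
  -- very term of the goal.
  θ-removal : ∀ {α} (0<α : 0# < α) {G G⁰ : Multigraph n} {i j} (i≢j : i ≢ j) → IsRemoval G G⁰ i j →
      Σ (θ G 0<α i≢j ≈ θ G⁰ 0<α i≢j + ε G i j) λ _ →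
      (ε G i j ≤ θ G 0<α i≢j)
    × ((θ G 0<α i≢j ≈ ε G i j) ⇔ (¬ JoinedToOutside G i j))
  θ-removal 0<α i≢j isRemoval = θ≈θ⁰+ε , ε≤θ , mk⇔ θ≈ε⇒¬joined ¬joined⇒θ≈ε
    where open Removal isRemoval 0<α i≢j

proposition6 : ∀ {c ℓ₁ ℓ₂ ℓ₃} (F : OrderedField c ℓ₁ ℓ₂ ℓ₃) →
    let open OrderedField F in
    let open Forest F in
    (α : Carrier) (0<α : 0# < α) (n : ℕ) (G : Multigraph n) (i j : Fin n) (i≢j : i ≢ j) →
    (θ G 0<α i≢j ≈ θ (removeEdges G i j) 0<α i≢j + ε G i j)
    × (ε G i j ≤ θ G 0<α i≢j)
    × ((θ G 0<α i≢j ≈ ε G i j) ⇔ (¬ JoinedToOutside G i j))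
proposition6 F α 0<α n G i j i≢j =
  θ-removal 0<α i≢j (removeEdges-isRemoval G i j)
  where open ForestProperties F
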